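{- Let $M(n)$ denote the Motzkin numbers. For each prime $p\in\{5,13,31,37,61,79,97,103\}$ and every integer $n\ge0$, $M(n)\not\equiv0\pmod{p^2}$. For every other prime $p<200$, there exists an integer $n\ge0$ such that $p^2$ divides $M(n)$.
   Context: The Motzkin numbers are $M(n)=\operatorname{ct}[(x^{ -1}+1+x)^n(1-x^2)]$, where $\operatorname{ct}$ denotes the constant term of a Laurent polynomial in $x$; equivalently $M(n)=\sum_{k\ge0}\binom{n}{2k}\frac{1}{k+1}\binom{2k}{k}$, so $M(0),M(1),\dots=1,1,2,4,9,21,51,\dots$. -}

module Defs where

open import Data.Nat using (ℕ; zero; suc; _+_; _*_; _/_)
open import Data.Nat.Combinatorics using (_C_)
open import Data.List using (List; []; _∷_; map; upTo)
open import Data.Nat.ListAction using (sum)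

-- Catalan number C_k = (1/(k+1)) * binom(2k,k)  (exact division)
catalan : ℕ → ℕ
catalan k = ((2 * k) C k) / suc k

-- Motzkin number M(n) = Σ_{k ≥ 0} binom(n,2k) * (1/(k+1)) * binom(2k,k)
-- (terms with 2k > n vanish, so summing k < n+1 suffices)
motzkin : ℕ → ℕ
motzkin n = sum (map (λ k → (n C (2 * k)) * catalan k) (upTo (suc n)))

exceptionalPrimes : List ℕ
exceptionalPrimes = 5 ∷ 13 ∷ 31 ∷ 37 ∷ 61 ∷ 79 ∷ 97 ∷ 103 ∷ []

module Submission where

-- Let T₀(n), T₁(n), T₂(n) be the coefficients of 1, x, x² in Pⁿ, where P = x⁻¹ + 1 + x.  Then
-- M(n) = T₀(n) - T₂(n), and the differential equation of Pⁿ yields (n+2) M(n) = 2 T₀(n) + T₁(n) and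
-- (n+1) M(n) = T₁(n+1), so everything is about linear forms in (T₀, T₁) modulo p².
-- As Pᵖ ≡ P(xᵖ) (mod p), expanding Pᵖᵐ = (P(xᵖ) + (Pᵖ - P(xᵖ)))ᵐ to first order determines it modulo p².
-- Reading off coefficients, the values of T₀ and T₁ at s + pm are linear forms in T₀(m), T₁(m) whose
-- coefficients are affine in m.  A linear form at n is thus transported through the base p digits of n, the
-- least significant first, by a finite automaton.  For the exceptional primes the automaton only reaches a
-- handful of forms besides multiples of T₀; those do not vanish at 0, and p never divides T₀.  For the other
-- primes some digit sequence leads to a form vanishing modulo p² at 0.

module TrinomialCoefficients where

  open import Defs using (catalan; motzkin)
  open import Data.Nat.Base as ℕ using (ℕ; zero; suc; s≤s; z≤n)
  import Data.Nat.Properties as ℕ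
  import Data.Nat.DivMod as ℕ
  import Data.Nat.Divisibility as ℕ
  import Data.Nat.Tactic.RingSolver as ℕ using (solve-∀)
  open import Data.Nat.Combinatorics using (_C_; nCk+nC[k+1]≡[n+1]C[k+1]; k>n⇒nCk≡0; nCn≡1)
  open import Data.Nat.Induction using (<-rec)
  open import Data.Nat.ListAction using (sum)
  open import Data.Nat.Primality using (Prime; euclidsLemma)
  open import Data.Integer.Base as ℤ using (ℤ; +_; +[1+_]; -[1+_]; 0ℤ; 1ℤ; _+_; _*_; _-_; -_)
  open import Data.Integer.Properties
  open import Data.Integer.Divisibility.Signed
  open import Data.Integer.Tactic.RingSolver using (solve-∀)
  open import Data.List.Base using (List; []; _∷_; _++_; replicate; drop; applyUpTo)
  import Data.List.Properties as List
  open import Data.List.Membership.Propositional using (_∈_; find)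
  import Data.List.Relation.Binary.Pointwise as Pointwise
  open Pointwise using (Pointwise; []; _∷_)
  open import Data.List.Relation.Unary.All as All using (All)
  open import Data.List.Relation.Unary.Any as Any using (Any)
  open import Data.Product using (_×_; _,_; proj₁; proj₂)
  open import Data.Sum using (_⊎_; inj₁; inj₂; [_,_]′)
  open import Data.Unit using (⊤; tt)
  open import Function using (_∘_)
  open import Relation.Binary.PropositionalEquality
  open import Relation.Nullary using (Dec; yes; ¬_; contradiction)
  open import Relation.Nullary.Decidable using (toSum; map′; _×-dec_; _⊎-dec_; _→-dec_; ¬?)

  -- Congruences and Laurent series

  infix 4 _≡_[mod_]
  -- A record rather than the bare divisibility, so that x and y can be inferred from the type of a
  -- congruence, which `x - y` alone would not determine.
  record _≡_[mod_] (x y N : ℤ) : Set where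
    constructor congruent
    field difference : N ∣ x - y
  open _≡_[mod_]

  module _ {N : ℤ} where
    mod-reflexive : ∀ {x y} → x ≡ y → x ≡ y [mod N ]
    mod-reflexive {x} refl = congruent (divides 0ℤ (+-inverseʳ x))

    mod-refl : ∀ x → x ≡ x [mod N ]
    mod-refl x = mod-reflexive refl

    mod-trans : ∀ {x y z} → x ≡ y [mod N ] → y ≡ z [mod N ] → x ≡ z [mod N ]
    mod-trans {x} {y} {z} (congruent p) (congruent q) =
      congruent (subst (N ∣_) (telescope x y z) (∣m∣n⇒∣m+n p q))
      where
      telescope : ∀ x y z → (x - y) + (y - z) ≡ x - z
      telescope = solve-∀

    mod-sym : ∀ {x y} → x ≡ y [mod N ] → y ≡ x [mod N ]
    mod-sym {x} {y} (congruent p) = congruent (subst (N ∣_) (flip x y) (∣m⇒∣-m p))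
      where
      flip : ∀ x y → - (x - y) ≡ y - x
      flip = solve-∀

    mod-+ : ∀ {x y u v} → x ≡ y [mod N ] → u ≡ v [mod N ] → x + u ≡ y + v [mod N ]
    mod-+ {x} {y} {u} {v} (congruent p) (congruent q) =
      congruent (subst (N ∣_) (regroup x y u v) (∣m∣n⇒∣m+n p q))
      where
      regroup : ∀ x y u v → (x - y) + (u - v) ≡ (x + u) - (y + v)
      regroup = solve-∀

    mod-*ˡ : ∀ c {x y} → x ≡ y [mod N ] → c * x ≡ c * y [mod N ]
    mod-*ˡ c {x} {y} (congruent p) = congruent (subst (N ∣_) (distrib c x y) (∣n⇒∣m*n c p))
      where
      distrib : ∀ c x y → c * (x - y) ≡ c * x - c * y
      distrib = solve-∀

    mod-*ʳ : ∀ c {x y} → x ≡ y [mod N ] → x * c ≡ y * c [mod N ]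
    mod-*ʳ c {x} {y} (congruent p) = congruent (subst (N ∣_) (distrib c x y) (∣m⇒∣m*n c p))
      where
      distrib : ∀ c x y → (x - y) * c ≡ x * c - y * c
      distrib = solve-∀

    mod-respects-∣ : ∀ {x y} → x ≡ y [mod N ] → N ∣ x → N ∣ y
    mod-respects-∣ {x} {y} e q = subst (N ∣_) (cancel x y) (∣m∣n⇒∣m+n q (difference (mod-sym e)))
      where
      cancel : ∀ x y → x + (y - x) ≡ y
      cancel = solve-∀

  Seq : Set
  Seq = ℤ → ℤ

  iter : {A : Set} → (A → A) → ℕ → A → A
  iter F zero    f = f
  iter F (suc n) f = F (iter F n f)

  iter-+ : {A : Set} (F : A → A) (m n : ℕ) (f : A) → iter F (m ℕ.+ n) f ≡ iter F m (iter F n f)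
  iter-+ F zero    n f = refl
  iter-+ F (suc m) n f = cong F (iter-+ F m n f)

  iter-* : {A : Set} (F : A → A) (m n : ℕ) (f : A) → iter F (m ℕ.* n) f ≡ iter (iter F n) m f
  iter-* F zero    n f = refl
  iter-* F (suc m) n f = trans (iter-+ F n (m ℕ.* n) f) (cong (iter F n) (iter-* F m n f))

  -- Multiplication of a Laurent series by x^a + 1 + x^(-a).
  spread : ℤ → Seq → Seq
  spread a f i = f (i + - a) + f i + f (i + a)

  +-swapʳ : ∀ i a b → i + a + b ≡ i + b + a
  +-swapʳ = solve-∀

  +-backforth : ∀ i a → i + - a + a ≡ i
  +-backforth = solve-∀

  +-forthback : ∀ i a → i + a + - a ≡ i
  +-forthback = solve-∀

  -- What the expansion of powers uses of multiplication by a fixed Laurent polynomial. Series are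
  -- functions compared pointwise, hence the field `ext`.
  record Convolution (F : Seq → Seq) : Set where
    field
      ext      : ∀ {f g} → f ≗ g → F f ≗ F g
      linear   : ∀ u v f g → F (λ i → u * f i + v * g i) ≗ λ i → u * F f i + v * F g i
      commutes : ∀ a f → F (spread a f) ≗ spread a (F f)
      mod-cong : ∀ {N f g} → (∀ i → f i ≡ g i [mod N ]) → ∀ i → F f i ≡ F g i [mod N ]
  open Convolution

  spread-convolution : ∀ a → Convolution (spread a)
  spread-convolution a .ext e i = cong₂ _+_ (cong₂ _+_ (e _) (e _)) (e _)
  spread-convolution a .linear u v f g i = lin u v _ _ _ _ _ _
    where
    lin : ∀ u v x y z x′ y′ z′ →
          (u * x + v * x′) + (u * y + v * y′) + (u * z + v * z′) ≡ u * (x + y + z) + v * (x′ + y′ + z′)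
    lin = solve-∀
  spread-convolution a .commutes b f i
    rewrite +-swapʳ i (- a) (- b) | +-swapʳ i (- a) b | +-swapʳ i a (- b) | +-swapʳ i a b
    = transpose (f (i + - b + - a)) (f (i + - a)) (f (i + b + - a))
                (f (i + - b)) (f i) (f (i + b)) (f (i + - b + a)) (f (i + a)) (f (i + b + a))
    where
    transpose : ∀ p q r s t u v w x →
      (p + q + r) + (s + t + u) + (v + w + x) ≡ (p + s + v) + (q + t + w) + (r + u + x)
    transpose = solve-∀
  spread-convolution a .mod-cong e i = mod-+ (mod-+ (e _) (e _)) (e _)

  iter-convolution : ∀ {F} → Convolution F → ∀ n → Convolution (iter F n)
  iter-convolution κ zero .ext e = e
  iter-convolution κ zero .linear u v f g i = refl
  iter-convolution κ zero .commutes a f i = refl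
  iter-convolution κ zero .mod-cong e = e
  iter-convolution κ (suc n) .ext e = ext κ (ext (iter-convolution κ n) e)
  iter-convolution κ (suc n) .linear u v f g i =
    trans (ext κ (linear (iter-convolution κ n) u v f g) i) (linear κ u v _ _ i)
  iter-convolution κ (suc n) .commutes a f i =
    trans (ext κ (commutes (iter-convolution κ n) a f) i) (commutes κ a _ i)
  iter-convolution κ (suc n) .mod-cong e = mod-cong κ (mod-cong (iter-convolution κ n) e)

  -- Trinomial coefficients and their recurrences

  δ : Seq
  δ (+ zero) = 1ℤ
  δ _        = 0ℤ

  trinomial : ℕ → Seq
  trinomial n = iter (spread 1ℤ) n δ

  δ-sym : ∀ i → δ (- i) ≡ δ i
  δ-sym (+ zero)  = refl
  δ-sym +[1+ n ]  = refl
  δ-sym -[1+ n ]  = refl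

  trinomial-sym : ∀ n i → trinomial n (- i) ≡ trinomial n i
  trinomial-sym zero    i = δ-sym i
  trinomial-sym (suc n) i = trans
    (cong₂ (λ x y → trinomial n x + trinomial n (- i) + trinomial n y) (negate i (- 1ℤ)) (negate i 1ℤ))
    (trans (cong₂ _+_ (cong₂ _+_ (trinomial-sym n (i + 1ℤ)) (trinomial-sym n i)) (trinomial-sym n (i + - 1ℤ)))
           (reverse (trinomial n (i + 1ℤ)) (trinomial n i) _))
    where
    negate : ∀ i a → - i + a ≡ - (i + - a)
    negate = solve-∀
    reverse : ∀ x y z → x + y + z ≡ z + y + x
    reverse = solve-∀

  i*δi≡0 : ∀ i → i * δ i ≡ 0ℤ
  i*δi≡0 (+ zero)  = refl
  i*δi≡0 +[1+ n ]  = *-zeroʳ +[1+ n ]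
  i*δi≡0 -[1+ n ]  = *-zeroʳ -[1+ n ]

  -- The differential equation P · x(Pⁿ)′ = n · xP′ · Pⁿ for P = x⁻¹ + 1 + x, read off coefficientwise.
  trinomial-differential : ∀ n i →
    (i + - 1ℤ) * trinomial n (i + - 1ℤ) + i * trinomial n i + (i + 1ℤ) * trinomial n (i + 1ℤ)
      ≡ + n * (trinomial n (i + - 1ℤ) - trinomial n (i + 1ℤ))
  trinomial-differential zero i
    rewrite i*δi≡0 (i + - 1ℤ) | i*δi≡0 i | i*δi≡0 (i + 1ℤ) = refl
  -- Multiplying the equation for n by P gives the one for n + 1, so its coefficient at i is the sum
  -- of the old ones at i - 1, i and i + 1.
  trinomial-differential (suc n) i
    rewrite +-backforth i 1ℤ | +-forthback i 1ℤ = i-j≡0⇒i≡j _ _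
      (trans (expand i (+ n) (x (i + - 1ℤ + - 1ℤ)) (x (i + - 1ℤ)) (x i) (x (i + 1ℤ)) (x (i + 1ℤ + 1ℤ)))
             (cong₂ _+_ (cong₂ _+_ (i≡j⇒i-j≡0 below) (i≡j⇒i-j≡0 (trinomial-differential n i))) (i≡j⇒i-j≡0 above)))
    where
    x = trinomial n
    below = subst (λ k → (i + - 1ℤ + - 1ℤ) * x (i + - 1ℤ + - 1ℤ) + (i + - 1ℤ) * x (i + - 1ℤ) + k * x k
                         ≡ + n * (x (i + - 1ℤ + - 1ℤ) - x k))
                  (+-backforth i 1ℤ) (trinomial-differential n (i + - 1ℤ))
    above = subst (λ k → k * x k + (i + 1ℤ) * x (i + 1ℤ) + (i + 1ℤ + 1ℤ) * x (i + 1ℤ + 1ℤ)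
                         ≡ + n * (x k - x (i + 1ℤ + 1ℤ)))
                  (+-forthback i 1ℤ) (trinomial-differential n (i + 1ℤ))
    expand : ∀ i n a b c d e →
      ((i + - 1ℤ) * (a + b + c) + i * (b + c + d) + (i + 1ℤ) * (c + d + e))
        - (1ℤ + n) * ((a + b + c) - (c + d + e))
      ≡ (((i + - 1ℤ + - 1ℤ) * a + (i + - 1ℤ) * b + i * c) - n * (a - c))
        + (((i + - 1ℤ) * b + i * c + (i + 1ℤ) * d) - n * (b - d))
        + ((i * c + (i + 1ℤ) * d + (i + 1ℤ + 1ℤ) * e) - n * (c - e))
    expand = solve-∀

  T₀ T₁ T₂ : ℕ → ℤ
  T₀ n = trinomial n (+ 0)
  T₁ n = trinomial n (+ 1)
  T₂ n = trinomial n (+ 2)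

  T₀-suc : ∀ n → T₀ (suc n) ≡ T₀ n + + 2 * T₁ n
  T₀-suc n rewrite trinomial-sym n 1ℤ = double (T₁ n) (T₀ n)
    where
    double : ∀ x y → x + y + x ≡ y + + 2 * x
    double = solve-∀

  -- The differential equation at i = 1, where the coefficient of `T₀` on the left vanishes.
  T₂-eliminate : ∀ n → (+ 2 + + n) * T₂ n ≡ + n * T₀ n - T₁ n
  T₂-eliminate n = i-j≡0⇒i≡j _ _ (trans (rearrange (+ n) (T₀ n) (T₁ n) (T₂ n))
    (i≡j⇒i-j≡0 (trinomial-differential n 1ℤ)))
    where
    rearrange : ∀ n a b c → (+ 2 + n) * c - (n * a - b)
      ≡ ((1ℤ + - 1ℤ) * a + 1ℤ * b + (1ℤ + 1ℤ) * c) - n * (a - c)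
    rearrange = solve-∀

  -- Runs the recurrence backwards: after `T₂` is eliminated, the values at n + 1 determine the one
  -- at n up to the factor 3 (n + 1). The form `U` below is this identity with the 3 inverted.
  T₀-pred : ∀ n → + 3 * (+ suc n * T₀ n) ≡ + 2 * (+ suc (suc n) * T₁ (suc n)) - + suc n * T₀ (suc n)
  T₀-pred n rewrite T₀-suc n = i-j≡0⇒i≡j _ _ (trans (rearrange (+ n) (T₀ n) (T₁ n) (T₂ n))
     (cong (- + 2 *_) (i≡j⇒i-j≡0 (T₂-eliminate n))))
    where
    rearrange : ∀ n a b c → + 3 * ((1ℤ + n) * a) - (+ 2 * ((+ 2 + n) * (a + b + c)) - (1ℤ + n) * (a + + 2 * b))
     ≡ - + 2 * ((+ 2 + n) * c - (n * a - b))
    rearrange = solve-∀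

  -- The first-order Frobenius expansion

  -- The list is paired with the values of f from index i upwards. Reading upwards still multiplies
  -- by the polynomial, because the rows used here are palindromic.
  convolve : List ℕ → Seq → Seq
  convolve []      f i = 0ℤ
  convolve (x ∷ c) f i = + x * f i + convolve c f (i + 1ℤ)

  -- Here x and y are the two entries just passed, so that `widen 0 0` multiplies by 1 + x + x² in a
  -- single pass.
  widen : ℕ → ℕ → List ℕ → List ℕ
  widen x y []      = x ℕ.+ y ∷ y ∷ []
  widen x y (z ∷ c) = x ℕ.+ y ℕ.+ z ∷ widen y z c

  row : ℕ → List ℕ
  row zero    = 1 ∷ []
  row (suc n) = widen 0 0 (row n)

  convolve-widen : ∀ x y c f i → convolve (widen x y c) f i ≡
    + x * f i + (+ y * f i + + y * f (i + 1ℤ))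
      + (convolve c f i + convolve c f (i + 1ℤ) + convolve c f (i + 1ℤ + 1ℤ))
  convolve-widen x y [] f i rewrite pos-+ x y = regroup (+ x) (+ y) _ _
    where
    regroup : ∀ x y a b → (x + y) * a + (y * b + 0ℤ) ≡ x * a + (y * a + y * b) + (0ℤ + 0ℤ + 0ℤ)
    regroup = solve-∀
  convolve-widen x y (z ∷ c) f i
    rewrite pos-+ (x ℕ.+ y) z | pos-+ x y | convolve-widen y z c f (i + 1ℤ)
    = regroup (+ x) (+ y) (+ z) (f i) (f (i + 1ℤ)) (f (i + 1ℤ + 1ℤ))
        (convolve c f (i + 1ℤ)) (convolve c f (i + 1ℤ + 1ℤ)) (convolve c f (i + 1ℤ + 1ℤ + 1ℤ))
    where
    regroup : ∀ x y z a b c u v w →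
      (x + y + z) * a + (y * b + (z * b + z * c) + (u + v + w))
      ≡ x * a + (y * a + y * b) + ((z * a + u) + (z * b + v) + (z * c + w))
    regroup = solve-∀

  iter-spread-row : ∀ n f i → iter (spread 1ℤ) n f i ≡ convolve (row n) f (i + - + n)
  iter-spread-row zero f i rewrite +-identityʳ i = unit (f i)
    where
    unit : ∀ x → x ≡ 1ℤ * x + 0ℤ
    unit = solve-∀
  iter-spread-row (suc n) f i
    rewrite convolve-widen 0 0 (row n) f (i + - (1ℤ + + n))
          | iter-spread-row n f (i + - 1ℤ) | iter-spread-row n f i | iter-spread-row n f (i + 1ℤ)
    = trans (cong₂ _+_ (cong₂ _+_ (cong g (low i (+ n))) (cong g (mid i (+ n)))) (cong g (high i (+ n))))
            (pad (f j) (f (j + 1ℤ)) (g j + g (j + 1ℤ) + g (j + 1ℤ + 1ℤ)))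
    where
    g = convolve (row n) f
    j = i + - (1ℤ + + n)
    low : ∀ i n → i + - 1ℤ + - n ≡ i + - (1ℤ + n)
    low = solve-∀
    mid : ∀ i n → i + - n ≡ i + - (1ℤ + n) + 1ℤ
    mid = solve-∀
    high : ∀ i n → i + 1ℤ + - n ≡ i + - (1ℤ + n) + 1ℤ + 1ℤ
    high = solve-∀
    pad : ∀ a b s → s ≡ 0ℤ * a + (0ℤ * a + 0ℤ * b) + s
    pad = solve-∀

  convolve-mod : ∀ {N c d} → Pointwise (λ x y → + x ≡ + y [mod N ]) c d →
                 ∀ f i → convolve c f i ≡ convolve d f i [mod N ]
  convolve-mod []       f i = mod-reflexive refl
  convolve-mod (e ∷ es) f i = mod-+ (mod-*ʳ (f i) e) (convolve-mod es f (i + 1ℤ))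

  convolve-zeros : ∀ z c f i → convolve (replicate z 0 ++ c) f i ≡ convolve c f (i + + z)
  convolve-zeros zero    c f i = cong (convolve c f) (sym (+-identityʳ i))
  convolve-zeros (suc z) c f i rewrite convolve-zeros z c f (i + 1ℤ) =
    trans (+-identityˡ _) (cong (convolve c f) (+-assoc i 1ℤ (+ z)))

  convolve-skip : ∀ n c f i → (∀ j → j ℕ.< n → f (i + + j) ≡ 0ℤ) →
                  convolve c f i ≡ convolve (drop n c) f (i + + n)
  convolve-skip zero    c       f i h = cong (convolve c f) (sym (+-identityʳ i))
  convolve-skip (suc n) []      f i h = refl
  convolve-skip (suc n) (x ∷ c) f i h = trans
    (cong₂ (λ u v → + x * u + v)
      (trans (cong f (sym (+-identityʳ i))) (h 0 (s≤s z≤n)))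
      (trans (convolve-skip n c f (i + 1ℤ)
               (λ j j<n → trans (cong f (+-assoc i 1ℤ (+ j))) (h (suc j) (s≤s j<n))))
             (cong (convolve (drop n c) f) (+-assoc i 1ℤ (+ n)))))
    (trans (cong (_+ _) (*-zeroʳ (+ x))) (+-identityˡ _))

  -- The coefficient list of xᵖ (x⁻ᵖ + 1 + xᵖ).
  spreadRow : ℕ → List ℕ
  spreadRow zero    = []
  spreadRow (suc p) = 1 ∷ replicate p 0 ++ 1 ∷ replicate p 0 ++ 1 ∷ []

  convolve-spreadRow : ∀ p f i → convolve (spreadRow (suc p)) f (i + - + suc p) ≡ spread (+ suc p) f i
  convolve-spreadRow p f i
    rewrite convolve-zeros p (1 ∷ replicate p 0 ++ 1 ∷ []) f (i + - + suc p + 1ℤ)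
          | convolve-zeros p (1 ∷ []) f (i + - + suc p + 1ℤ + + p + 1ℤ)
    = trans (cong₂ (λ u v → 1ℤ * f (i + - + suc p) + (1ℤ * f u + (1ℤ * f v + 0ℤ))) (mid i (+ p)) (high i (+ p)))
            (unit (f (i + - + suc p)) (f i) (f (i + + suc p)))
    where
    mid : ∀ i p → i + - (1ℤ + p) + 1ℤ + p ≡ i
    mid = solve-∀
    high : ∀ i p → i + - (1ℤ + p) + 1ℤ + p + 1ℤ + p ≡ i + (1ℤ + p)
    high = solve-∀
    unit : ∀ a b c → 1ℤ * a + (1ℤ * b + (1ℤ * c + 0ℤ)) ≡ a + b + c
    unit = solve-∀

  -- Powers of P(xᵖ) and sampling at multiples of p

  module _ (p : ℕ) where

    -- Multiplication by P(xᵖ) does not mix residue classes modulo p; on each class it acts as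
    -- multiplication by P.
    subsequence : ∀ m {f g} j → (∀ q → f (j + + p * q) ≡ g q) →
                  ∀ q → iter (spread (+ p)) m f (j + + p * q) ≡ iter (spread 1ℤ) m g q
    subsequence zero    j h q = h q
    subsequence (suc m) {f} {g} j h q = cong₂ _+_ (cong₂ _+_
        (trans (cong F (low j (+ p) q)) (subsequence m j h (q + - 1ℤ)))
        (subsequence m j h q))
        (trans (cong F (high j (+ p) q)) (subsequence m j h (q + 1ℤ)))
      where
      F = iter (spread (+ p)) m f
      low : ∀ j p q → j + p * q + - p ≡ j + p * (q + - 1ℤ)
      low = solve-∀
      high : ∀ j p q → j + p * q + p ≡ j + p * (q + 1ℤ)
      high = solve-∀

    dilated : ℕ → Seq
    dilated m = iter (spread (+ p)) m δ

  iter-zero : ∀ m i → iter (spread 1ℤ) m (λ _ → 0ℤ) i ≡ 0ℤ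
  iter-zero zero    i = refl
  iter-zero (suc m) i rewrite iter-zero m (i + - 1ℤ) | iter-zero m i | iter-zero m (i + 1ℤ) = refl

  δ-dilate : ∀ p q → δ (+ 0 + + suc p * q) ≡ δ q
  δ-dilate p (+ zero) rewrite ℕ.*-zeroʳ p = refl
  δ-dilate p +[1+ n ]  = refl
  δ-dilate p -[1+ n ]  = refl

  δ-nonzero : ∀ {i} → i ≢ 0ℤ → δ i ≡ 0ℤ
  δ-nonzero {+ zero}   i≢0 = contradiction refl i≢0
  δ-nonzero { +[1+ n ]} i≢0 = refl
  δ-nonzero { -[1+ n ]} i≢0 = refl

  δ-off : ∀ p j → j ℕ.< p → ∀ q → δ (+ suc j + + suc p * q) ≡ 0ℤ
  δ-off p j j<p q = δ-nonzero λ e →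
    contradiction (∣⇒∣ᵤ (divides (- q) (solve-j e))) (ℕ.>⇒∤ (s≤s j<p))
    where
    shuffle : ∀ x p q → x ≡ (x + p * q) + - q * p
    shuffle = solve-∀
    solve-j : + suc j + + suc p * q ≡ 0ℤ → + suc j ≡ - q * + suc p
    solve-j e = trans (shuffle (+ suc j) (+ suc p) q) (trans (cong (_+ - q * + suc p) e) (+-identityˡ _))

  dilated-at : ∀ p m q → dilated (suc p) m (+ suc p * q) ≡ trinomial m q
  dilated-at p m q = trans (cong (dilated (suc p) m) (sym (+-identityˡ (+ suc p * q))))
    (subsequence (suc p) m 0ℤ (δ-dilate p) q)

  dilated-off : ∀ p m q j → j ℕ.< p → dilated (suc p) m (+ suc p * q + 1ℤ + + j) ≡ 0ℤ
  dilated-off p m q j j<p = trans (cong (dilated (suc p) m) (reorder (+ suc p * q) (+ j)))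
    (trans (subsequence (suc p) m (+ suc j) (δ-off p j j<p) q) (iter-zero m q))
    where
    reorder : ∀ x j → x + 1ℤ + j ≡ (1ℤ + j) + x
    reorder = solve-∀

  head₀ : List ℕ → ℕ
  head₀ []      = 0
  head₀ (x ∷ _) = x

  -- Starting at a multiple of `suc p`, the first entry meets a trinomial coefficient and the next p
  -- entries meet zeros.
  convolve-dilated : ∀ p m c q → convolve c (dilated (suc p) m) (+ suc p * q) ≡
    + head₀ c * trinomial m q + convolve (drop (suc p) c) (dilated (suc p) m) (+ suc p * (q + 1ℤ))
  convolve-dilated p m []      q = refl
  convolve-dilated p m (x ∷ c) q = cong₂ (λ u v → + x * u + v) (dilated-at p m q)
    (trans (convolve-skip p c (dilated (suc p) m) (+ suc p * q + 1ℤ) (dilated-off p m q))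
           (cong (convolve (drop p c) (dilated (suc p) m)) (next (+ p) q)))
    where
    next : ∀ p q → (1ℤ + p) * q + 1ℤ + p ≡ (1ℤ + p) * (q + 1ℤ)
    next = solve-∀

  record Readout : Set where
    constructor readout
    field c₀ c₁ c₂ : ℕ

  stride : ℕ → List ℕ → ℕ → ℕ
  stride p c k = head₀ (iter (drop p) k c)

  -- The coefficients of x⁰, x^(±p), x^(±2p) in a Laurent polynomial listed from x^(-2p) on.
  sample : ℕ → List ℕ → Readout
  sample p c = readout (stride p c 2) (stride p c 1 ℕ.+ stride p c 3) (stride p c 0 ℕ.+ stride p c 4)

  -- The first entry of row s belongs to index i - s; the zeros move the start to -2p. The truncated
  -- subtraction is exact under `Readable`.
  window : ℕ → ℕ → ℕ → List ℕ → List ℕ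
  window p s i c = replicate (2 ℕ.* p ℕ.+ i ℕ.∸ s) 0 ++ c

  _·_ : Readout → ℕ → ℤ
  readout c₀ c₁ c₂ · m = + c₀ * T₀ m + + c₁ * T₁ m + + c₂ * T₂ m

  -- Only five entries survive, one per stride, and the symmetry of the trinomial coefficients
  -- merges those at ±p and those at ±2p.
  convolve-sample : ∀ p m c → iter (drop (suc p)) 5 c ≡ [] →
    convolve c (dilated (suc p) m) (+ suc p * - + 2) ≡ sample (suc p) c · m
  convolve-sample p m c short
    rewrite convolve-dilated p m c (- + 2)
          | convolve-dilated p m (drop (suc p) c) (- + 1)
          | convolve-dilated p m (iter (drop (suc p)) 2 c) (+ 0)
          | convolve-dilated p m (iter (drop (suc p)) 3 c) (+ 1)
          | convolve-dilated p m (iter (drop (suc p)) 4 c) (+ 2)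
          | short
          | trinomial-sym m (+ 1) | trinomial-sym m (+ 2)
          | pos-+ (stride (suc p) c 1) (stride (suc p) c 3) | pos-+ (stride (suc p) c 0) (stride (suc p) c 4)
    = collect (+ stride (suc p) c 0) (+ stride (suc p) c 1) (+ stride (suc p) c 2)
        (+ stride (suc p) c 3) (+ stride (suc p) c 4) (T₀ m) (T₁ m) (T₂ m)
    where
    collect : ∀ a b c d e x y z →
      a * z + (b * y + (c * x + (d * y + (e * z + 0ℤ)))) ≡ c * x + (b + d) * y + (a + e) * z
    collect = solve-∀

  -- Five strides of length p exhaust the window, so that sampling it at multiples of p loses nothing.
  Readable : ℕ → ℕ → ℕ → List ℕ → Set
  Readable p s i c = (s ℕ.≤ 2 ℕ.* p ℕ.+ i) × iter (drop p) 5 (window p s i c) ≡ []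

  iter-spread-sample : ∀ p s i m → Readable (suc p) s i (row s) →
    iter (spread 1ℤ) s (dilated (suc p) m) (+ i) ≡ sample (suc p) (window (suc p) s i (row s)) · m
  iter-spread-sample p s i m (s≤2p+i , short) = trans (iter-spread-row s (dilated (suc p) m) (+ i))
    (trans (trans (cong (convolve (row s) (dilated (suc p) m)) offset)
                  (sym (convolve-zeros z (row s) (dilated (suc p) m) (+ suc p * - + 2))))
           (convolve-sample p m (window (suc p) s i (row s)) short))
    where
    z = 2 ℕ.* suc p ℕ.+ i ℕ.∸ s
    shuffle : ∀ p i s z → z + s ≡ + 2 * p + i → i + - s ≡ p * - + 2 + z
    shuffle p i s z e = i-j≡0⇒i≡j _ _ (trans (rearrange p i s z) (cong -_ (i≡j⇒i-j≡0 e)))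
      where
      rearrange : ∀ p i s z → (i + - s) - (p * - + 2 + z) ≡ - ((z + s) - (+ 2 * p + i))
      rearrange = solve-∀
    offset : + i + - + s ≡ + suc p * - + 2 + + z
    offset = shuffle (+ suc p) (+ i) (+ s) (+ z)
      (trans (cong +_ (ℕ.m∸n+n≡m s≤2p+i)) (cong (_+ + i) (pos-* 2 (suc p))))

  -- The congruence Pᵖ ≡ P(xᵖ) as a comparison of coefficient lists, so that it is decided by
  -- evaluation for each p.
  Frobenius : ℕ → Set
  Frobenius p = Pointwise (λ x y → + x ≡ + y [mod + p ]) (row p) (spreadRow p)

  module _ (p : ℕ) (frob : Frobenius (suc p)) where
    private
      P P² : ℤ
      P  = + suc p
      P² = + (suc p ℕ.* suc p)
      A B Δ : Seq → Seq
      A = iter (spread 1ℤ) (suc p)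
      B = spread P
      Δ f i = A f i - B f i
      conv-A : Convolution A
      conv-A = iter-convolution (spread-convolution 1ℤ) (suc p)
      conv-B : Convolution B
      conv-B = spread-convolution P

    frobenius : ∀ f i → P ∣ Δ f i
    frobenius f i rewrite iter-spread-row (suc p) f i | sym (convolve-spreadRow p f i) =
      difference (convolve-mod frob f (i + - P))

    private
      Δ-scale : ∀ c f → Δ (λ i → c * f i) ≗ λ i → c * Δ f i
      Δ-scale c f i = trans (cong₂ _-_ (scale conv-A) (scale conv-B)) (factor c (A f i) (B f i))
        where
        drop-zero : ∀ c x → c * x ≡ c * x + 0ℤ * x
        drop-zero = solve-∀
        scale : ∀ {F} → Convolution F → F (λ i → c * f i) i ≡ c * F f i
        scale κ = trans (ext κ (λ i → drop-zero c (f i)) i)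
                        (trans (linear κ c 0ℤ f f i) (sym (drop-zero c _)))
        factor : ∀ c x y → c * x - c * y ≡ c * (x - y)
        factor = solve-∀

      Δ-ext : ∀ {f g} → f ≗ g → Δ f ≗ Δ g
      Δ-ext e i = cong₂ _-_ (ext conv-A e i) (ext conv-B e i)

      -- Write Δ f as p q; then Δ (Δ f) = p Δ q, and p divides Δ q once more.
      Δ² : ∀ f i → P² ∣ Δ (Δ f) i
      Δ² f i with frobenius q i
        where q = λ j → quotient (frobenius f j)
      ... | divides r eq = divides r (trans
        (Δ-ext (λ j → trans (_∣_.equality (frobenius f j)) (*-comm _ P)) i)
        (trans (Δ-scale P _ i) (trans (cong (P *_) eq) (reassoc P r))))
        where
        reassoc : ∀ P r → P * (r * P) ≡ r * (P * P)
        reassoc = solve-∀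

      -- The operators `A` and `B` commute, so (A - B)² expands as usual.
      Δ²-expand : ∀ f i → Δ (Δ f) i ≡ A (A f) i - + 2 * A (B f) i + B (B f) i
      Δ²-expand f i = trans (cong₂ _-_ (minus conv-A) (minus conv-B))
        (trans (cong (λ x → A (A f) i - A (B f) i - (x - B (B f) i)) (sym (commutes conv-A P f i)))
               (expand (A (A f) i) (A (B f) i) (B (B f) i)))
        where
        sub : ∀ x y → x - y ≡ 1ℤ * x + - 1ℤ * y
        sub = solve-∀
        minus : ∀ {F} → Convolution F → F (Δ f) i ≡ F (A f) i - F (B f) i
        minus {F} κ = trans (ext κ (λ i → sub (A f i) (B f i)) i)
          (trans (linear κ 1ℤ (- 1ℤ) (A f) (B f) i) (sym (sub (F (A f) i) (F (B f) i))))
        expand : ∀ x y z → (x - y) - (y - z) ≡ x - + 2 * y + z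
        expand = solve-∀

    -- The first two terms of the binomial expansion of (B + (A - B))^(k+1).
    frobenius-power : ∀ k i → iter A (suc k) δ i ≡
      + suc k * A (dilated (suc p) k) i + - + k * dilated (suc p) (suc k) i [mod P² ]
    frobenius-power zero    i = mod-reflexive (unit (A δ i) (B δ i))
      where
      unit : ∀ x y → x ≡ 1ℤ * x + - 0ℤ * y
      unit = solve-∀
    -- Applying `A` to the case k misses the claim by k + 1 times (A - B)² of `dilated (suc p) k`, a
    -- multiple of p².
    frobenius-power (suc k) i = mod-trans (mod-cong conv-A (frobenius-power k) i)
      (mod-trans (mod-reflexive (linear conv-A (+ suc k) (- + k) _ _ i))
        (congruent (subst (P² ∣_) (trans (cong (+ suc k *_) (Δ²-expand f i))
                                     (regroup (+ k) (A (A f) i) (A (B f) i) (B (B f) i)))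
                          (∣n⇒∣m*n (+ suc k) (Δ² f i)))))
      where
      f = dilated (suc p) k
      regroup : ∀ k x y z → (1ℤ + k) * (x - + 2 * y + z)
        ≡ ((1ℤ + k) * x + - k * y) - ((+ 2 + k) * y + - (1ℤ + k) * z)
      regroup = solve-∀

    trinomial-mod : ∀ r k i → trinomial (r ℕ.+ suc k ℕ.* suc p) i ≡
        + suc k * iter (spread 1ℤ) (r ℕ.+ suc p) (dilated (suc p) k) i
        + - + k * iter (spread 1ℤ) r (dilated (suc p) (suc k)) i [mod P² ]
    trinomial-mod r k i
      rewrite iter-+ (spread 1ℤ) r (suc k ℕ.* suc p) δ | iter-* (spread 1ℤ) (suc k) (suc p) δ
            | iter-+ (spread 1ℤ) r (suc p) (dilated (suc p) k)
      = mod-trans (mod-cong conv-r (frobenius-power k) i)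
                  (mod-reflexive (linear conv-r (+ suc k) (- + k) _ _ i))
      where
      conv-r = iter-convolution (spread-convolution 1ℤ) r

  -- Linear forms in T₀ and T₁ along base p digits

  record State : Set where
    no-eta-equality
    pattern
    constructor ⟨_,_,_,_⟩
    field a b c d : ℤ

  ⟦_⟧ : State → ℕ → ℤ
  ⟦ ⟨ a , b , c , d ⟩ ⟧ m = (a + + m * b) * T₀ m + (c + + m * d) * T₁ m

  infixl 6 _⊕_
  infixr 7 _⊛_
  _⊕_ : State → State → State
  ⟨ a , b , c , d ⟩ ⊕ ⟨ a′ , b′ , c′ , d′ ⟩ = ⟨ a + a′ , b + b′ , c + c′ , d + d′ ⟩

  _⊛_ : ℤ → State → State
  u ⊛ ⟨ a , b , c , d ⟩ = ⟨ u * a , u * b , u * c , u * d ⟩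

  ⟦⟧-⊕ : ∀ σ τ m → ⟦ σ ⊕ τ ⟧ m ≡ ⟦ σ ⟧ m + ⟦ τ ⟧ m
  ⟦⟧-⊕ ⟨ a , b , c , d ⟩ ⟨ a′ , b′ , c′ , d′ ⟩ m = regroup a b c d a′ b′ c′ d′ (+ m) (T₀ m) (T₁ m)
    where
    regroup : ∀ a b c d a′ b′ c′ d′ m x y →
      (a + a′ + m * (b + b′)) * x + (c + c′ + m * (d + d′)) * y
      ≡ ((a + m * b) * x + (c + m * d) * y) + ((a′ + m * b′) * x + (c′ + m * d′) * y)
    regroup = solve-∀

  ⟦⟧-⊛ : ∀ u σ m → ⟦ u ⊛ σ ⟧ m ≡ u * ⟦ σ ⟧ m
  ⟦⟧-⊛ u ⟨ a , b , c , d ⟩ m = regroup u a b c d (+ m) (T₀ m) (T₁ m)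
    where
    regroup : ∀ u a b c d m x y →
      (u * a + m * (u * b)) * x + (u * c + m * (u * d)) * y ≡ u * ((a + m * b) * x + (c + m * d) * y)
    regroup = solve-∀

  private variable N : ℤ

  infix 4 _≋_[mod_]
  _≋_[mod_] : State → State → ℤ → Set
  ⟨ a , b , c , d ⟩ ≋ ⟨ a′ , b′ , c′ , d′ ⟩ [mod N ] =
    a ≡ a′ [mod N ] × b ≡ b′ [mod N ] × c ≡ c′ [mod N ] × d ≡ d′ [mod N ]

  ⟦⟧-mod : ∀ σ τ → σ ≋ τ [mod N ] → ∀ m → ⟦ σ ⟧ m ≡ ⟦ τ ⟧ m [mod N ]
  ⟦⟧-mod ⟨ _ , _ , _ , _ ⟩ ⟨ _ , _ , _ , _ ⟩ (a , b , c , d) m = mod-+ (mod-*ʳ (T₀ m) (mod-+ a (mod-*ˡ (+ m) b)))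
                                   (mod-*ʳ (T₁ m) (mod-+ c (mod-*ˡ (+ m) d)))

  -- Rewriting values at m - 1 as forms at m

  module Elimination (s : ℤ) where

    -- With s inverse to 6, these represent m T₀(m-1), m T₁(m-1) and m T₂(m-1).
    U V W : State
    U = ⟨ 0ℤ , - (+ 2 * s) , + 4 * s , + 4 * s ⟩
    V = (+ 3 * s) ⊛ (⟨ 0ℤ , 1ℤ , 0ℤ , 0ℤ ⟩ ⊕ - 1ℤ ⊛ U)
    W = ⟨ 0ℤ , 0ℤ , 0ℤ , 1ℤ ⟩ ⊕ - 1ℤ ⊛ U ⊕ - 1ℤ ⊛ V

    -- The shape of `trinomial-mod` at m = k + 1: the sample x of Pˢ has weight 1 - m, and the
    -- sample y of Pˢ⁺ᵖ has weight m, which `U`, `V`, `W` absorb in passing from m - 1 to m.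
    combine : Readout → Readout → State
    combine (readout x₀ x₁ _) (readout y₀ y₁ y₂) =
      ⟨ + x₀ , - + x₀ , + x₁ , - + x₁ ⟩ ⊕ + y₀ ⊛ U ⊕ + y₁ ⊛ V ⊕ + y₂ ⊛ W

    ⟦combine⟧ : ∀ x y m → let open Readout in ⟦ combine x y ⟧ m ≡
      + c₀ x * ((1ℤ - + m) * T₀ m) + + c₁ x * ((1ℤ - + m) * T₁ m)
        + + c₀ y * ⟦ U ⟧ m + + c₁ y * ⟦ V ⟧ m + + c₂ y * ⟦ W ⟧ m
    ⟦combine⟧ (readout x₀ x₁ _) (readout y₀ y₁ y₂) m =
      trans (⟦⟧-⊕ (σ ⊕ + y₀ ⊛ U ⊕ + y₁ ⊛ V) (+ y₂ ⊛ W) m) (cong₂ _+_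
        (trans (⟦⟧-⊕ (σ ⊕ + y₀ ⊛ U) (+ y₁ ⊛ V) m) (cong₂ _+_
          (trans (⟦⟧-⊕ σ (+ y₀ ⊛ U) m) (cong₂ _+_ (regroup (+ x₀) (+ x₁) (+ m) (T₀ m) (T₁ m))
            (⟦⟧-⊛ (+ y₀) U m)))
          (⟦⟧-⊛ (+ y₁) V m)))
        (⟦⟧-⊛ (+ y₂) W m))
      where
      σ = ⟨ + x₀ , - + x₀ , + x₁ , - + x₁ ⟩
      regroup : ∀ x y m t u → (x + m * - x) * t + (y + m * - y) * u
        ≡ x * ((1ℤ - m) * t) + y * ((1ℤ - m) * u)
      regroup = solve-∀

    module _ (sixth : + 6 * s ≡ 1ℤ [mod N ]) (k : ℕ) where
      private m = + suc k

      cancel-sixth : ∀ x → s * (+ 6 * x) ≡ x [mod N ]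
      cancel-sixth x = mod-trans (mod-reflexive (assoc s x))
        (mod-trans (mod-*ʳ x sixth) (mod-reflexive (*-identityˡ x)))
        where
        assoc : ∀ s x → s * (+ 6 * x) ≡ + 6 * s * x
        assoc = solve-∀

      ⟦U⟧ : ⟦ U ⟧ (suc k) ≡ m * T₀ k [mod N ]
      ⟦U⟧ = mod-trans (mod-reflexive
              (trans (expand s m (T₀ (suc k)) (T₁ (suc k)))
                     (trans (cong (λ z → s * (+ 2 * z)) (sym (T₀-pred k))) (regroup s (m * T₀ k)))))
              (cancel-sixth (m * T₀ k))
        where
        expand : ∀ s m x y → (0ℤ + m * - (+ 2 * s)) * x + (+ 4 * s + m * (+ 4 * s)) * y
          ≡ s * (+ 2 * (+ 2 * ((1ℤ + m) * y) - m * x))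
        expand = solve-∀
        regroup : ∀ s x → s * (+ 2 * (+ 3 * x)) ≡ s * (+ 6 * x)
        regroup = solve-∀

      -- From T₀(m) = T₀(m-1) + 2 T₁(m-1), where 3s inverts 2.
      ⟦V⟧ : ⟦ V ⟧ (suc k) ≡ m * T₁ k [mod N ]
      ⟦V⟧ = mod-trans (mod-reflexive (expand s m (T₀ (suc k)) (T₁ (suc k))))
        (mod-trans (mod-*ˡ (+ 3 * s) (mod-+ (mod-reflexive (cong (m *_) (T₀-suc k))) (mod-*ˡ (- 1ℤ) ⟦U⟧)))
        (mod-trans (mod-reflexive (regroup s m (T₀ k) (T₁ k))) (cancel-sixth (m * T₁ k))))
        where
        expand : ∀ s m x y →
          ((+ 3 * s) * (0ℤ + - 1ℤ * 0ℤ) + m * ((+ 3 * s) * (1ℤ + - 1ℤ * - (+ 2 * s)))) * x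
            + ((+ 3 * s) * (0ℤ + - 1ℤ * (+ 4 * s)) + m * ((+ 3 * s) * (0ℤ + - 1ℤ * (+ 4 * s)))) * y
          ≡ (+ 3 * s) * (m * x + - 1ℤ * ((0ℤ + m * - (+ 2 * s)) * x + (+ 4 * s + m * (+ 4 * s)) * y))
        expand = solve-∀
        regroup : ∀ s m x y → (+ 3 * s) * (m * (x + + 2 * y) + - 1ℤ * (m * x)) ≡ s * (+ 6 * (m * y))
        regroup = solve-∀

      -- From T₁(m) = T₀(m-1) + T₁(m-1) + T₂(m-1).
      ⟦W⟧ : ⟦ W ⟧ (suc k) ≡ m * T₂ k [mod N ]
      ⟦W⟧ = mod-trans (mod-reflexive
          (trans (⟦⟧-⊕ (e ⊕ - 1ℤ ⊛ U) (- 1ℤ ⊛ V) (suc k))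
            (cong₂ _+_ (trans (⟦⟧-⊕ e (- 1ℤ ⊛ U) (suc k))
                              (cong₂ _+_ (unit m (T₀ (suc k)) (T₁ (suc k))) (⟦⟧-⊛ (- 1ℤ) U (suc k))))
                       (⟦⟧-⊛ (- 1ℤ) V (suc k)))))
        (mod-trans (mod-+ (mod-+ (mod-refl (m * T₁ (suc k))) (mod-*ˡ (- 1ℤ) ⟦U⟧)) (mod-*ˡ (- 1ℤ) ⟦V⟧))
                   (mod-reflexive (regroup m (T₀ k) (T₁ k) (T₂ k))))
        where
        e = ⟨ 0ℤ , 0ℤ , 0ℤ , 1ℤ ⟩
        unit : ∀ m x y → (0ℤ + m * 0ℤ) * x + (0ℤ + m * 1ℤ) * y ≡ m * y
        unit = solve-∀
        regroup : ∀ m x y z → m * (x + y + z) + - 1ℤ * (m * x) + - 1ℤ * (m * y) ≡ m * z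
        regroup = solve-∀

  -- As p² ≡ 1 (mod 24) for p coprime to 6, this inverts 6 modulo p².
  sixth : ℕ → ℤ
  sixth p = - + ((p ℕ.* p) ℕ./ 6)

  transition : ℕ → ℕ → List ℕ → List ℕ → ℕ → State
  transition p s c c′ i = Elimination.combine (sixth p)
    (sample p (window p s i c)) (sample p (window p (s ℕ.+ p) i c′))

  -- The last condition removes T₂(m), which could be expressed by T₀(m) and T₁(m) only after a
  -- division by m + 2. For s < p and i ≤ 1 the power Pˢ is too short to reach it.
  ValidAt : ℕ → ℕ → List ℕ → List ℕ → ℕ → Set
  ValidAt p s c c′ i = Readable p s i c × Readable p (s ℕ.+ p) i c′
                       × Readout.c₂ (sample p (window p s i c)) ≡ 0

  step : State → ℕ → State → State → State
  step ⟨ a , b , c , d ⟩ s τ₀ τ₁ = (a + + s * b) ⊛ τ₀ ⊕ (c + + s * d) ⊛ τ₁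

  -- Makes a + n b and c + n d depend modulo p² only on n modulo p, so that `step` may evaluate them
  -- at the digit s.
  Regular : ℕ → State → Set
  Regular p ⟨ a , b , c , d ⟩ = + p ∣ b × + p ∣ d

  Suitable : ℕ → Set
  Suitable p = Frobenius p × + 6 * sixth p ≡ 1ℤ [mod + (p ℕ.* p) ]

  module _ (p-1 : ℕ) (suitable : Suitable (suc p-1)) where
    private
      p  = suc p-1
      P² = + (p ℕ.* p)

    transition-sound : ∀ s m i → ValidAt p s (row s) (row (s ℕ.+ p)) i →
      trinomial (s ℕ.+ m ℕ.* p) (+ i) ≡ ⟦ transition p s (row s) (row (s ℕ.+ p)) i ⟧ m [mod P² ]
    -- The Frobenius expansion covers only positive m. At m = 0 the forms `U`, `V`, `W` vanish, and
    -- the sample of Pˢ alone gives the value.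
    transition-sound s zero i (r , r′ , x₂≡0) rewrite ℕ.+-identityʳ s =
      mod-reflexive (trans (iter-spread-sample p-1 s i 0 r)
        (trans (collapse (+ c₀ x) (+ c₁ x) (+ c₂ x) (⟦ U ⟧ 0) (⟦ V ⟧ 0) (⟦ W ⟧ 0) (+ c₀ y) (+ c₁ y) (+ c₂ y)
                 (zero-U (sixth p)) (zero-V (sixth p)) (zero-W (sixth p)))
               (sym (⟦combine⟧ x y 0))))
      where
      open Readout
      open Elimination (sixth p)
      x = sample p (window p s i (row s))
      y = sample p (window p (s ℕ.+ p) i (row (s ℕ.+ p)))
      collapse : ∀ x₀ x₁ x₂ u v w y₀ y₁ y₂ → u ≡ 0ℤ → v ≡ 0ℤ → w ≡ 0ℤ →
        x₀ * 1ℤ + x₁ * 0ℤ + x₂ * 0ℤ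
        ≡ x₀ * ((1ℤ - 0ℤ) * 1ℤ) + x₁ * ((1ℤ - 0ℤ) * 0ℤ) + y₀ * u + y₁ * v + y₂ * w
      collapse x₀ x₁ x₂ u v w y₀ y₁ y₂ refl refl refl = ring x₀ x₁ x₂ y₀ y₁ y₂
        where
        ring : ∀ x₀ x₁ x₂ y₀ y₁ y₂ → x₀ * 1ℤ + x₁ * 0ℤ + x₂ * 0ℤ
          ≡ x₀ * ((1ℤ - 0ℤ) * 1ℤ) + x₁ * ((1ℤ - 0ℤ) * 0ℤ) + y₀ * 0ℤ + y₁ * 0ℤ + y₂ * 0ℤ
        ring = solve-∀
      at-0 : ∀ b c d → ⟦ ⟨ 0ℤ , b , c , d ⟩ ⟧ 0 ≡ 0ℤ
      at-0 = vanish
        where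
        vanish : ∀ b c d → (0ℤ + 0ℤ * b) * 1ℤ + (c + 0ℤ * d) * 0ℤ ≡ 0ℤ
        vanish = solve-∀
      zero-U : ∀ s → ⟦ Elimination.U s ⟧ 0 ≡ 0ℤ
      zero-U s = at-0 (- (+ 2 * s)) (+ 4 * s) (+ 4 * s)
      zero-V : ∀ s → ⟦ Elimination.V s ⟧ 0 ≡ 0ℤ
      zero-V s = trans (⟦⟧-⊛ (+ 3 * s) (e ⊕ - 1ℤ ⊛ Elimination.U s) 0)
        (trans (cong (+ 3 * s *_) (trans (⟦⟧-⊕ e (- 1ℤ ⊛ Elimination.U s) 0)
           (trans (+-identityˡ _) (trans (⟦⟧-⊛ (- 1ℤ) (Elimination.U s) 0) (cong (- 1ℤ *_) (zero-U s))))))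
          (*-zeroʳ (+ 3 * s)))
        where e = ⟨ 0ℤ , 1ℤ , 0ℤ , 0ℤ ⟩
      zero-W : ∀ s → ⟦ Elimination.W s ⟧ 0 ≡ 0ℤ
      zero-W s = trans (⟦⟧-⊕ (e ⊕ - 1ℤ ⊛ Elimination.U s) (- 1ℤ ⊛ Elimination.V s) 0)
        (cong₂ _+_ (trans (⟦⟧-⊕ e (- 1ℤ ⊛ Elimination.U s) 0)
                     (cong (λ z → 0ℤ + z) (trans (⟦⟧-⊛ (- 1ℤ) (Elimination.U s) 0) (cong (- 1ℤ *_) (zero-U s)))))
                   (trans (⟦⟧-⊛ (- 1ℤ) (Elimination.V s) 0) (cong (- 1ℤ *_) (zero-V s))))
        where e = ⟨ 0ℤ , 0ℤ , 0ℤ , 1ℤ ⟩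
    transition-sound s (suc k) i (r , r′ , x₂≡0)
      = mod-trans (trinomial-mod p-1 (proj₁ suitable) s k (+ i))
        (mod-trans (mod-reflexive (cong₂ (λ u v → + suc k * u + - + k * v)
            (iter-spread-sample p-1 (s ℕ.+ p) i k r′) (iter-spread-sample p-1 s i (suc k) r)))
        (mod-trans (mod-reflexive (trans
            (cong (λ z → + suc k * (y · k) + - + k * (+ c₀ x * T₀ m + + c₁ x * T₁ m + + z * T₂ m)) x₂≡0)
            (regroup (+ k) (+ c₀ x) (+ c₁ x) (+ c₀ y) (+ c₁ y) (+ c₂ y)
              (T₀ m) (T₁ m) (T₂ m) (T₀ k) (T₁ k) (T₂ k))))
        (mod-trans (mod-+ (mod-+ (mod-+ (mod-refl (+ c₀ x * ((1ℤ - + m) * T₀ m) + + c₁ x * ((1ℤ - + m) * T₁ m)))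
                     (mod-*ˡ (+ c₀ y) (mod-sym (⟦U⟧ six k))))
                     (mod-*ˡ (+ c₁ y) (mod-sym (⟦V⟧ six k))))
                     (mod-*ˡ (+ c₂ y) (mod-sym (⟦W⟧ six k))))
        (mod-reflexive (sym (⟦combine⟧ x y m))))))
      where
      open Readout
      open Elimination (sixth p)
      m = suc k
      six = proj₂ suitable
      x = sample p (window p s i (row s))
      y = sample p (window p (s ℕ.+ p) i (row (s ℕ.+ p)))
      regroup : ∀ k x₀ x₁ y₀ y₁ y₂ t₀ t₁ t₂ u₀ u₁ u₂ →
        (1ℤ + k) * (y₀ * u₀ + y₁ * u₁ + y₂ * u₂) + - k * (x₀ * t₀ + x₁ * t₁ + 0ℤ * t₂)
        ≡ x₀ * ((1ℤ - (1ℤ + k)) * t₀) + x₁ * ((1ℤ - (1ℤ + k)) * t₁)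
          + y₀ * ((1ℤ + k) * u₀) + y₁ * ((1ℤ + k) * u₁) + y₂ * ((1ℤ + k) * u₂)
      regroup = solve-∀

    step-sound : ∀ σ τ₀ τ₁ s m → Regular p σ →
      T₀ (s ℕ.+ m ℕ.* p) ≡ ⟦ τ₀ ⟧ m [mod P² ] → T₁ (s ℕ.+ m ℕ.* p) ≡ ⟦ τ₁ ⟧ m [mod P² ] →
      ⟦ σ ⟧ (s ℕ.+ m ℕ.* p) ≡ ⟦ step σ s τ₀ τ₁ ⟧ m [mod P² ]
    step-sound ⟨ a , b , c , d ⟩ τ₀ τ₁ s m (p∣b , p∣d) e₀ e₁ =
      mod-trans (mod-+ (mod-trans (mod-*ʳ (T₀ n) (absorb a p∣b)) (mod-*ˡ (a + + s * b) e₀))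
                       (mod-trans (mod-*ʳ (T₁ n) (absorb c p∣d)) (mod-*ˡ (c + + s * d) e₁)))
        (mod-reflexive (sym (trans (⟦⟧-⊕ ((a + + s * b) ⊛ τ₀) ((c + + s * d) ⊛ τ₁) m)
          (cong₂ _+_ (⟦⟧-⊛ (a + + s * b) τ₀ m) (⟦⟧-⊛ (c + + s * d) τ₁ m)))))
      where
      n = s ℕ.+ m ℕ.* p
      absorb : ∀ x {y} → + p ∣ y → x + + n * y ≡ x + + s * y [mod P² ]
      absorb x (divides q refl) = congruent (divides (+ m * q)
        (trans (cong (λ z → (x + z * (q * + p)) - (x + + s * (q * + p)))
                     (trans (pos-+ s (m ℕ.* p)) (cong (λ z → + s + z) (pos-* m p))))
               (regroup x (+ s) (+ m) q (+ p))))
        where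
        regroup : ∀ x s m q p → (x + (s + m * p) * (q * p)) - (x + s * (q * p)) ≡ m * q * (p * p)
        regroup = solve-∀

  -- Digit induction and divisibility by p²

  digit-induction : ∀ p-2 (Q : ℕ → Set) → Q 0 →
    (∀ s m → s ℕ.< 2 ℕ.+ p-2 → Q m → Q (s ℕ.+ m ℕ.* (2 ℕ.+ p-2))) → ∀ n → Q n
  digit-induction p-2 Q base next = <-rec Q go
    where
    p = 2 ℕ.+ p-2
    go : ∀ n → (∀ {m} → m ℕ.< n → Q m) → Q n
    go zero      rec = base
    go n@(suc _) rec = subst Q (sym (ℕ.m≡m%n+[m/n]*n n p))
      (next (n ℕ.% p) (n ℕ./ p) (ℕ.m%n<n n p) (rec (ℕ.m/n<m n p (s≤s (s≤s z≤n)))))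

  -- Euclid's lemma twice, with one factor p cancelled in between.
  prime-square-∣ : ∀ {p x y} → Prime p → ¬ (p ℕ.∣ y) → p ℕ.* p ℕ.∣ x ℕ.* y → p ℕ.* p ℕ.∣ x
  prime-square-∣ {zero}        pr p∤y p²∣xy = contradiction pr λ ()
  prime-square-∣ {p@(suc _)} {x} {y} pr p∤y p²∣xy
    with euclidsLemma x y pr (ℕ.∣-trans (ℕ.m∣m*n p) p²∣xy)
  ... | inj₂ p∣y = contradiction p∣y p∤y
  ... | inj₁ (ℕ.divides q refl) with euclidsLemma q y pr
          (ℕ.*-cancelʳ-∣ p (subst (p ℕ.* p ℕ.∣_) (swap q p y) p²∣xy))
    where
    swap : ∀ q p y → q ℕ.* p ℕ.* y ≡ q ℕ.* y ℕ.* p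
    swap q p y = trans (ℕ.*-assoc q p y) (trans (cong (q ℕ.*_) (ℕ.*-comm p y)) (sym (ℕ.*-assoc q y p)))
  ... | inj₁ p∣q = ℕ.*-monoˡ-∣ p p∣q
  ... | inj₂ p∣y = contradiction p∣y p∤y

  prime-square-∣ℤ : ∀ {p x y} → Prime p → ¬ (+ p ∣ y) → + (p ℕ.* p) ∣ x * y → + (p ℕ.* p) ∣ x
  prime-square-∣ℤ {p} {x} {y} pr p∤y p²∣xy = ∣ᵤ⇒∣ (prime-square-∣ {p} {ℤ.∣ x ∣} pr (p∤y ∘ ∣ᵤ⇒∣)
    (subst (p ℕ.* p ℕ.∣_) (abs-* x y) (∣⇒∣ᵤ p²∣xy)))

  prime-∣ℤ : ∀ {p x y} → Prime p → ¬ (+ p ∣ x) → ¬ (+ p ∣ y) → ¬ (+ p ∣ x * y)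
  prime-∣ℤ {p} {x} {y} pr p∤x p∤y p∣xy
    with euclidsLemma ℤ.∣ x ∣ ℤ.∣ y ∣ pr (subst (p ℕ.∣_) (abs-* x y) (∣⇒∣ᵤ p∣xy))
  ... | inj₁ p∣x = p∤x (∣ᵤ⇒∣ p∣x)
  ... | inj₂ p∣y = p∤y (∣ᵤ⇒∣ p∣y)

  ⟦⟧-0 : ∀ σ → ⟦ σ ⟧ 0 ≡ State.a σ
  ⟦⟧-0 ⟨ a , b , c , d ⟩ = simplify a b c d
    where
    simplify : ∀ a b c d → (a + 0ℤ * b) * 1ℤ + (c + 0ℤ * d) * 0ℤ ≡ a
    simplify = solve-∀

  -- Closed automata and nonvanishing modulo p²

  MultipleOfT₀ : ℕ → State → Set
  MultipleOfT₀ N ⟨ a , b , c , d ⟩ = ¬ (+ N ∣ a) × + N ∣ b × + N ∣ c × + N ∣ d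

  multipleOfT₀-mod : ∀ {N} σ → MultipleOfT₀ N σ → ∀ m → ⟦ σ ⟧ m ≡ State.a σ * T₀ m [mod + N ]
  multipleOfT₀-mod ⟨ a , b , c , d ⟩ (_ , N∣b , N∣c , N∣d) m = congruent (subst (_ ∣_)
    (regroup a b c d (+ m) (T₀ m) (T₁ m))
    (∣m∣n⇒∣m+n (∣n⇒∣m*n (+ m * T₀ m) N∣b)
               (∣m∣n⇒∣m+n (∣n⇒∣m*n (T₁ m) N∣c) (∣n⇒∣m*n (+ m * T₁ m) N∣d))))
    where
    regroup : ∀ a b c d m x y → m * x * b + (y * c + m * y * d) ≡ (a + m * b) * x + (c + m * d) * y - a * x
    regroup = solve-∀

  coefficient-nonzero : ∀ {N} σ → MultipleOfT₀ N σ → ¬ (+ N ∣ State.a σ)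
  coefficient-nonzero ⟨ _ , _ , _ , _ ⟩ = proj₁

  -- A nonzero multiple of `T₀` modulo p², one modulo p (tested after multiplying by p), or a listed
  -- state. The first two end a path through the automaton, since p never divides `T₀`.
  Admissible : ℕ → List State → State → Set
  Admissible p S σ = MultipleOfT₀ (p ℕ.* p) σ ⊎ MultipleOfT₀ (p ℕ.* p) (+ p ⊛ σ)
                     ⊎ Any (σ ≋_[mod + (p ℕ.* p) ]) S

  -- The two starting forms: the first is (n+2) M(n) at n, the second (n+1) M(n) read at the index n
  -- + 1.
  2T₀+T₁ T₁-only : State
  2T₀+T₁  = ⟨ + 2 , 0ℤ , 1ℤ , 0ℤ ⟩
  T₁-only = ⟨ 0ℤ , 0ℤ , 1ℤ , 0ℤ ⟩

  ⟦2T₀+T₁⟧ : ∀ n → ⟦ 2T₀+T₁ ⟧ n ≡ + 2 * T₀ n + T₁ n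
  ⟦2T₀+T₁⟧ n = simplify (+ n) (T₀ n) (T₁ n)
    where
    simplify : ∀ n x y → (+ 2 + n * 0ℤ) * x + (1ℤ + n * 0ℤ) * y ≡ + 2 * x + y
    simplify = solve-∀

  ⟦T₁-only⟧ : ∀ n → ⟦ T₁-only ⟧ n ≡ T₁ n
  ⟦T₁-only⟧ n = simplify (+ n) (T₀ n) (T₁ n)
    where
    simplify : ∀ n x y → (0ℤ + n * 0ℤ) * x + (1ℤ + n * 0ℤ) * y ≡ y
    simplify = solve-∀

  -- Demanded of every listed state: regularity, so that another digit can be read, and a nonzero
  -- value where the digits end. As T₀(0) = 1 and T₁(0) = 0, that value is a.
  Initial : ℕ → State → Set
  Initial p σ = Regular p σ × ¬ (+ (p ℕ.* p) ∣ State.a σ)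

  -- The first condition carries p ∤ `T₀` across a digit. If the lowest digit of n is p - 2, the
  -- start is `T₁-only` at n + 1, whose lowest digit is p - 1; otherwise it is `2T₀+T₁` at n.
  ClosedUnder : ℕ → List State → ℕ → State → State → Set
  ClosedUnder p S s τ₀ τ₁ =
      MultipleOfT₀ p τ₀
    × All (λ σ → Admissible p S (step σ s τ₀ τ₁)) S
    × (2 ℕ.+ s ≢ p → Admissible p S (step 2T₀+T₁ s τ₀ τ₁))
    × (1 ℕ.+ s ≡ p → Admissible p S (step T₁-only s τ₀ τ₁))

  ClosedAt : ℕ → List State → ℕ → List ℕ → List ℕ → Set
  ClosedAt p S s c c′ = ValidAt p s c c′ 0 × ValidAt p s c c′ 1
    × ClosedUnder p S s (transition p s c c′ 0) (transition p s c c′ 1)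

  -- Carries the rows s and s + p along, so that the closure test computes each row once.
  AllDigits : (ℕ → List ℕ → List ℕ → Set) → ℕ → ℕ → List ℕ → List ℕ → Set
  AllDigits Q zero    s c c′ = ⊤
  AllDigits Q (suc k) s c c′ = Q s c c′ × AllDigits Q k (suc s) (widen 0 0 c) (widen 0 0 c′)

  allDigits-lookup : ∀ Q k s p → AllDigits Q k s (row s) (row (s ℕ.+ p)) →
                     ∀ j → j ℕ.< k → Q (j ℕ.+ s) (row (j ℕ.+ s)) (row (j ℕ.+ s ℕ.+ p))
  allDigits-lookup Q (suc k) s p (q , qs) zero    j<k       = q
  allDigits-lookup Q (suc k) s p (q , qs) (suc j) (s≤s j<k) =
    subst (λ n → Q n (row n) (row (n ℕ.+ p))) (ℕ.+-suc j s) (allDigits-lookup Q k (suc s) p qs j j<k)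

  Closed : ℕ → List State → Set
  Closed p S = Suitable p × All (Initial p) S × AllDigits (ClosedAt p S) p 0 (row 0) (row p)

  module Automaton
    (p-2 : ℕ)
    (p-prime : Prime (2 ℕ.+ p-2))
    (suitable : Suitable (2 ℕ.+ p-2))
    (τ₀ τ₁ : ℕ → State)
    (T₀-digit : ∀ {s} → s ℕ.< 2 ℕ.+ p-2 → ∀ m → T₀ (s ℕ.+ m ℕ.* (2 ℕ.+ p-2)) ≡ ⟦ τ₀ s ⟧ m
                  [mod + ((2 ℕ.+ p-2) ℕ.* (2 ℕ.+ p-2)) ])
    (T₁-digit : ∀ {s} → s ℕ.< 2 ℕ.+ p-2 → ∀ m → T₁ (s ℕ.+ m ℕ.* (2 ℕ.+ p-2)) ≡ ⟦ τ₁ s ⟧ m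
                  [mod + ((2 ℕ.+ p-2) ℕ.* (2 ℕ.+ p-2)) ])
    (S : List State)
    (initial : All (Initial (2 ℕ.+ p-2)) S)
    (closed : ∀ {s} → s ℕ.< 2 ℕ.+ p-2 → ClosedUnder (2 ℕ.+ p-2) S s (τ₀ s) (τ₁ s))
    where

    private
      p  = 2 ℕ.+ p-2
      P² = + (p ℕ.* p)

    step-digit : ∀ σ → Regular p σ → ∀ {s} → s ℕ.< p → ∀ m →
      ⟦ σ ⟧ (s ℕ.+ m ℕ.* p) ≡ ⟦ step σ s (τ₀ s) (τ₁ s) ⟧ m [mod P² ]
    step-digit σ regular {s} s<p m =
      step-sound (suc p-2) suitable σ (τ₀ s) (τ₁ s) s m regular (T₀-digit s<p m) (T₁-digit s<p m)

    -- As in Lucas' theorem, T₀(s + m p) is modulo p a unit times T₀(m), and T₀(0) = 1.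
    p∤T₀ : ∀ n → ¬ (+ p ∣ T₀ n)
    p∤T₀ = digit-induction p-2 (λ n → ¬ (+ p ∣ T₀ n)) (ℕ.>⇒∤ (s≤s (s≤s z≤n)) ∘ ∣⇒∣ᵤ)
      λ s m s<p p∤T₀m p∣T₀ →
        let multiple = proj₁ (closed s<p) in
        prime-∣ℤ p-prime (coefficient-nonzero (τ₀ s) multiple) p∤T₀m
          (mod-respects-∣ (mod-trans (congruent (∣-trans (divides (+ p) refl) (difference (T₀-digit s<p m))))
                                     (multipleOfT₀-mod (τ₀ s) multiple m)) p∣T₀)

    multipleOfT₀-nonzero : ∀ σ → MultipleOfT₀ (p ℕ.* p) σ → ∀ m → ¬ (P² ∣ ⟦ σ ⟧ m)
    multipleOfT₀-nonzero σ multiple m P²∣σ = coefficient-nonzero σ multiple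
      (prime-square-∣ℤ {x = State.a σ} p-prime (p∤T₀ m) (mod-respects-∣ (multipleOfT₀-mod σ multiple m) P²∣σ))

    -- Induction on the digits of m for all admissible forms at once, as reading a digit changes the
    -- form: `step` takes a listed state to an admissible one by closedness.
    admissible-nonzero : ∀ m σ → Admissible p S σ → ¬ (P² ∣ ⟦ σ ⟧ m)
    admissible-nonzero = digit-induction p-2 (λ m → ∀ σ → Admissible p S σ → ¬ (P² ∣ ⟦ σ ⟧ m))
      (cases 0 λ τ τ∈S → proj₂ (All.lookup initial τ∈S) ∘ subst (P² ∣_) (⟦⟧-0 τ))
      (λ s m s<p rec → cases (s ℕ.+ m ℕ.* p) λ τ τ∈S →
        rec (step τ s (τ₀ s) (τ₁ s)) (All.lookup (proj₁ (proj₂ (closed s<p))) τ∈S)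
          ∘ mod-respects-∣ (step-digit τ (proj₁ (All.lookup initial τ∈S)) s<p m))
      where
      cases : ∀ n → (∀ τ → τ ∈ S → ¬ (P² ∣ ⟦ τ ⟧ n)) → ∀ σ → Admissible p S σ → ¬ (P² ∣ ⟦ σ ⟧ n)
      cases n h σ (inj₁ multiple)        P²∣σ = multipleOfT₀-nonzero σ multiple n P²∣σ
      cases n h σ (inj₂ (inj₁ multiple)) P²∣σ = multipleOfT₀-nonzero (+ p ⊛ σ) multiple n
        (subst (P² ∣_) (sym (⟦⟧-⊛ (+ p) σ n)) (∣n⇒∣m*n (+ p) P²∣σ))
      cases n h σ (inj₂ (inj₂ σ∈S))      P²∣σ =
        let (τ , τ∈S , σ≋τ) = find σ∈S in h τ τ∈S (mod-respects-∣ (⟦⟧-mod σ τ σ≋τ n) P²∣σ)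

    2T₀+T₁-nonzero : ∀ {s} → s ℕ.< p → 2 ℕ.+ s ≢ p → ∀ m →
      ¬ (P² ∣ + 2 * T₀ (s ℕ.+ m ℕ.* p) + T₁ (s ℕ.+ m ℕ.* p))
    2T₀+T₁-nonzero {s} s<p s+2≢p m P²∣ =
      admissible-nonzero m (step 2T₀+T₁ s (τ₀ s) (τ₁ s)) (proj₁ (proj₂ (proj₂ (closed s<p))) s+2≢p)
        (mod-respects-∣ (step-digit 2T₀+T₁ (divides 0ℤ refl , divides 0ℤ refl) s<p m)
          (subst (P² ∣_) (sym (⟦2T₀+T₁⟧ (s ℕ.+ m ℕ.* p))) P²∣))

    T₁-nonzero : ∀ {s} → s ℕ.< p → 1 ℕ.+ s ≡ p → ∀ m → ¬ (P² ∣ T₁ (s ℕ.+ m ℕ.* p))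
    T₁-nonzero {s} s<p s+1≡p m P²∣ =
      admissible-nonzero m (step T₁-only s (τ₀ s) (τ₁ s)) (proj₂ (proj₂ (proj₂ (closed s<p))) s+1≡p)
        (mod-respects-∣ (step-digit T₁-only (divides 0ℤ refl , divides 0ℤ refl) s<p m)
          (subst (P² ∣_) (sym (⟦T₁-only⟧ (s ℕ.+ m ℕ.* p))) P²∣))

  RowTransition : ℕ → ℕ → ℕ → State
  RowTransition p i s = transition p s (row s) (row (s ℕ.+ p)) i

  -- For n ≡ -2 (mod p) the factor n + 2 is lost, and (n+1) M(n) = T₁(n+1) is used instead.
  closed⇒p²∤ : ∀ p-2 S → let p = 2 ℕ.+ p-2 in Prime p → Closed p S → ∀ M n →
    (+ 2 + + n) * M ≡ + 2 * T₀ n + T₁ n → (1ℤ + + n) * M ≡ T₁ (suc n) → ¬ (+ (p ℕ.* p) ∣ M)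
  closed⇒p²∤ p-2 S pr (suitable , initial , digits) M n 2T₀+T₁≡ T₁≡ P²∣M =
    -- Passing to n + 1 causes no carry: its lowest digit is s + 1 = p - 1, and m is unchanged.
    [ (λ 2+s≡p → T₁-nonzero (subst (suc s ℕ.<_) 2+s≡p (ℕ.n<1+n (suc s))) 2+s≡p m
        (subst (λ k → P² ∣ T₁ (suc k)) n≡ (subst (P² ∣_) T₁≡ (∣n⇒∣m*n (1ℤ + + n) P²∣M))))
    , (λ 2+s≢p → 2T₀+T₁-nonzero s<p 2+s≢p m
        (subst (λ k → P² ∣ + 2 * T₀ k + T₁ k) n≡ (subst (P² ∣_) 2T₀+T₁≡ (∣n⇒∣m*n (+ 2 + + n) P²∣M))))
    ]′ (toSum (2 ℕ.+ s ℕ.≟ p))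
    where
    p  = 2 ℕ.+ p-2
    P² = + (p ℕ.* p)
    s = n ℕ.% p
    m = n ℕ./ p
    s<p = ℕ.m%n<n n p
    n≡ : n ≡ s ℕ.+ m ℕ.* p
    n≡ = ℕ.m≡m%n+[m/n]*n n p
    closedAt : ∀ {s} → s ℕ.< p → ClosedAt p S s (row s) (row (s ℕ.+ p))
    closedAt {s} s<p = subst (λ n → ClosedAt p S n (row n) (row (n ℕ.+ p))) (ℕ.+-identityʳ s)
      (allDigits-lookup (ClosedAt p S) p 0 p digits s s<p)
    open Automaton p-2 pr suitable (RowTransition p 0) (RowTransition p 1)
      (λ {s} s<p m → transition-sound (suc p-2) suitable s m 0 (proj₁ (closedAt s<p)))
      (λ {s} s<p m → transition-sound (suc p-2) suitable s m 1 (proj₁ (proj₂ (closedAt s<p))))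
      S initial (λ s<p → proj₂ (proj₂ (closedAt s<p)))

  -- Digit sequences leading to zero modulo p²

  fromDigits : ℕ → List ℕ → ℕ
  fromDigits p []       = 0
  fromDigits p (s ∷ ss) = s ℕ.+ fromDigits p ss ℕ.* p

  -- `VanishesAt` receives the two rows as arguments, so that all its conditions share them.
  Vanishes : ℕ → State → List ℕ → Set
  VanishesAt : ℕ → State → ℕ → List ℕ → List ℕ → List ℕ → Set
  Vanishes p σ []       = + (p ℕ.* p) ∣ State.a σ
  Vanishes p σ (s ∷ ss) = VanishesAt p σ s (row s) (row (s ℕ.+ p)) ss
  VanishesAt p σ s c c′ ss = Regular p σ × ValidAt p s c c′ 0 × ValidAt p s c c′ 1
    × Vanishes p (step σ s (transition p s c c′ 0) (transition p s c c′ 1)) ss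

  vanishes-sound : ∀ p-1 → let p = suc p-1 in Suitable p → ∀ σ ss → Vanishes p σ ss →
                   + (p ℕ.* p) ∣ ⟦ σ ⟧ (fromDigits p ss)
  vanishes-sound p-1 suitable σ [] P²∣a = subst (_ ∣_) (sym (⟦⟧-0 σ)) P²∣a
  vanishes-sound p-1 suitable σ (s ∷ ss) (regular , v₀ , v₁ , vanishes) =
    mod-respects-∣ (mod-sym (step-sound p-1 suitable σ (RowTransition p 0 s) (RowTransition p 1 s) s m regular
        (transition-sound p-1 suitable s m 0 v₀) (transition-sound p-1 suitable s m 1 v₁)))
      (vanishes-sound p-1 suitable _ ss vanishes)
    where
    p = suc p-1
    m = fromDigits p ss

  Witness : ℕ → List ℕ → Set
  Witness p ss = Suitable p × Vanishes p 2T₀+T₁ ss × ¬ (p ℕ.∣ 2 ℕ.+ fromDigits p ss)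

  -- The form `2T₀+T₁` yields p² ∣ (n + 2) M, and n + 2 cancels because p does not divide it.
  witness⇒p²∣ : ∀ p-1 ss → let p = suc p-1 ; n = fromDigits p ss in Prime p → Witness p ss → ∀ M →
    (+ 2 + + n) * M ≡ + 2 * T₀ n + T₁ n → + (p ℕ.* p) ∣ M
  witness⇒p²∣ p-1 ss pr (suitable , vanishes , p∤n+2) M 2T₀+T₁≡ =
    prime-square-∣ℤ {x = M} pr (p∤n+2 ∘ ∣⇒∣ᵤ) (subst (_ ∣_)
      (trans (⟦2T₀+T₁⟧ n) (trans (sym 2T₀+T₁≡) (*-comm (+ 2 + + n) M)))
      (vanishes-sound p-1 suitable 2T₀+T₁ ss vanishes))
    where n = fromDigits (suc p-1) ss

  -- Decision procedures

  mod? : ∀ x y N → Dec (x ≡ y [mod N ])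
  mod? x y N = map′ congruent difference (N ∣? x - y)

  suitable? : ∀ p → Dec (Suitable p)
  suitable? p = Pointwise.decidable (λ x y → mod? (+ x) (+ y) (+ p)) (row p) (spreadRow p)
    ×-dec mod? (+ 6 * sixth p) 1ℤ (+ (p ℕ.* p))

  regular? : ∀ p σ → Dec (Regular p σ)
  regular? p ⟨ a , b , c , d ⟩ = (+ p ∣? b) ×-dec (+ p ∣? d)

  readable? : ∀ p s i c → Dec (Readable p s i c)
  readable? p s i c = (s ℕ.≤? 2 ℕ.* p ℕ.+ i) ×-dec List.≡-dec ℕ._≟_ (iter (drop p) 5 (window p s i c)) []

  validAt? : ∀ p s c c′ i → Dec (ValidAt p s c c′ i)
  validAt? p s c c′ i = readable? p s i c ×-dec readable? p (s ℕ.+ p) i c′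
    ×-dec (Readout.c₂ (sample p (window p s i c)) ℕ.≟ 0)

  vanishes?   : ∀ p σ ss → Dec (Vanishes p σ ss)
  vanishesAt? : ∀ p σ s c c′ ss → Dec (VanishesAt p σ s c c′ ss)
  vanishes? p σ []       = + (p ℕ.* p) ∣? State.a σ
  vanishes? p σ (s ∷ ss) = vanishesAt? p σ s (row s) (row (s ℕ.+ p)) ss
  vanishesAt? p σ s c c′ ss = regular? p σ ×-dec validAt? p s c c′ 0 ×-dec validAt? p s c c′ 1
    ×-dec vanishes? p (step σ s (transition p s c c′ 0) (transition p s c c′ 1)) ss

  witness? : ∀ p ss → Dec (Witness p ss)
  witness? p ss = suitable? p ×-dec vanishes? p 2T₀+T₁ ss ×-dec ¬? (p ℕ.∣? 2 ℕ.+ fromDigits p ss)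

  ≋? : ∀ σ τ N → Dec (σ ≋ τ [mod N ])
  ≋? ⟨ a , b , c , d ⟩ ⟨ a′ , b′ , c′ , d′ ⟩ N =
    mod? a a′ N ×-dec mod? b b′ N ×-dec mod? c c′ N ×-dec mod? d d′ N

  multipleOfT₀? : ∀ N σ → Dec (MultipleOfT₀ N σ)
  multipleOfT₀? N ⟨ a , b , c , d ⟩ =
    ¬? (+ N ∣? a) ×-dec (+ N ∣? b) ×-dec (+ N ∣? c) ×-dec (+ N ∣? d)

  admissible? : ∀ p S σ → Dec (Admissible p S σ)
  admissible? p S σ = multipleOfT₀? (p ℕ.* p) σ ⊎-dec multipleOfT₀? (p ℕ.* p) (+ p ⊛ σ)
    ⊎-dec Any.any? (λ τ → ≋? σ τ (+ (p ℕ.* p))) S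

  closedUnder? : ∀ p S s τ₀ τ₁ → Dec (ClosedUnder p S s τ₀ τ₁)
  closedUnder? p S s τ₀ τ₁ = multipleOfT₀? p τ₀
    ×-dec All.all? (λ σ → admissible? p S (step σ s τ₀ τ₁)) S
    ×-dec (¬? (2 ℕ.+ s ℕ.≟ p) →-dec admissible? p S (step 2T₀+T₁ s τ₀ τ₁))
    ×-dec ((1 ℕ.+ s ℕ.≟ p) →-dec admissible? p S (step T₁-only s τ₀ τ₁))

  closedAt? : ∀ p S s c c′ → Dec (ClosedAt p S s c c′)
  closedAt? p S s c c′ = validAt? p s c c′ 0 ×-dec validAt? p s c c′ 1
    ×-dec closedUnder? p S s (transition p s c c′ 0) (transition p s c c′ 1)

  allDigits? : ∀ {Q} → (∀ s c c′ → Dec (Q s c c′)) → ∀ k s c c′ → Dec (AllDigits Q k s c c′)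
  allDigits? Q? zero    s c c′ = yes tt
  allDigits? Q? (suc k) s c c′ = Q? s c c′ ×-dec allDigits? Q? k (suc s) (widen 0 0 c) (widen 0 0 c′)

  initial? : ∀ p σ → Dec (Initial p σ)
  initial? p σ = regular? p σ ×-dec ¬? (+ (p ℕ.* p) ∣? State.a σ)

  closed? : ∀ p S → Dec (Closed p S)
  closed? p S = suitable? p ×-dec All.all? (initial? p) S ×-dec allDigits? (closedAt? p S) p 0 (row 0) (row p)

  -- Motzkin numbers as trinomial coefficients

  absorption : ∀ n k → suc k ℕ.* (suc n C suc k) ≡ suc n ℕ.* (n C k)
  absorption zero    zero    = refl
  absorption zero    (suc k) = trans (cong (suc (suc k) ℕ.*_) (k>n⇒nCk≡0 {1} {suc (suc k)} (s≤s (s≤s z≤n))))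
    (trans (ℕ.*-zeroʳ (suc (suc k))) (sym (cong (1 ℕ.*_) (k>n⇒nCk≡0 {0} {suc k} (s≤s z≤n)))))
  absorption (suc n) zero    = trans (ℕ.*-identityˡ (suc (suc n) C 1))
    (trans (sym (nCk+nC[k+1]≡[n+1]C[k+1] (suc n) 0))
      (trans (cong (1 ℕ.+_) (trans (sym (ℕ.*-identityˡ (suc n C 1))) (absorption n 0)))
             (trans (cong (1 ℕ.+_) (ℕ.*-identityʳ (suc n))) (sym (ℕ.*-identityʳ (suc (suc n)))))))
  absorption (suc n) (suc k) = begin
    suc (suc k) ℕ.* (suc (suc n) C suc (suc k))
      ≡⟨ cong (suc (suc k) ℕ.*_) (nCk+nC[k+1]≡[n+1]C[k+1] (suc n) (suc k)) ⟨
    suc (suc k) ℕ.* (x ℕ.+ (suc n C suc (suc k)))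
      ≡⟨ ℕ.*-distribˡ-+ (suc (suc k)) x (suc n C suc (suc k)) ⟩
    suc (suc k) ℕ.* x ℕ.+ suc (suc k) ℕ.* (suc n C suc (suc k))
      ≡⟨ cong (suc (suc k) ℕ.* x ℕ.+_) (absorption n (suc k)) ⟩
    x ℕ.+ suc k ℕ.* x ℕ.+ suc n ℕ.* (n C suc k)
      ≡⟨ cong (λ z → x ℕ.+ z ℕ.+ suc n ℕ.* (n C suc k)) (absorption n k) ⟩
    x ℕ.+ suc n ℕ.* (n C k) ℕ.+ suc n ℕ.* (n C suc k)
      ≡⟨ collect x (suc n) (n C k) (n C suc k) ⟩
    x ℕ.+ suc n ℕ.* ((n C k) ℕ.+ (n C suc k))
      ≡⟨ cong (λ z → x ℕ.+ suc n ℕ.* z) (nCk+nC[k+1]≡[n+1]C[k+1] n k) ⟩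
    x ℕ.+ suc n ℕ.* x
      ∎
    where
    open ≡-Reasoning
    x = suc n C suc k
    collect : ∀ x n y z → x ℕ.+ n ℕ.* y ℕ.+ n ℕ.* z ≡ x ℕ.+ n ℕ.* (y ℕ.+ z)
    collect = ℕ.solve-∀

  -- The ballot identity, with C(2k+2, k) moved to the left to avoid a subtraction.
  catalan-ballot : ∀ k → catalan (suc k) ℕ.+ ((k ℕ.+ suc (suc k)) C k) ≡ (suc k ℕ.+ suc k) C suc k
  catalan-ballot k = begin
    catalan (suc k) ℕ.+ b
      ≡⟨ cong (λ n → (n C suc k) ℕ./ (2 ℕ.+ k) ℕ.+ b) (double k) ⟩
    a ℕ./ (2 ℕ.+ k) ℕ.+ b
      ≡⟨ cong (λ z → z ℕ./ (2 ℕ.+ k) ℕ.+ b) a-factor ⟩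
    (a ℕ.∸ b) ℕ.* (2 ℕ.+ k) ℕ./ (2 ℕ.+ k) ℕ.+ b
      ≡⟨ cong (ℕ._+ b) (ℕ.m*n/n≡m (a ℕ.∸ b) (2 ℕ.+ k)) ⟩
    a ℕ.∸ b ℕ.+ b
      ≡⟨ ℕ.m∸n+n≡m b≤a ⟩
    a ∎
    where
    open ≡-Reasoning
    n = suc k ℕ.+ suc k
    a = n C suc k
    b = (k ℕ.+ suc (suc k)) C k
    double : ∀ k → 2 ℕ.* suc k ≡ suc k ℕ.+ suc k
    double = ℕ.solve-∀
    ratio : suc k ℕ.* a ≡ (2 ℕ.+ k) ℕ.* b
    -- With (k+1) b added, Pascal's rule makes the left side (k+1) C(n+1, k+1), which absorption
    -- turns into (n+1) b.
    ratio = ℕ.+-cancelˡ-≡ (suc k ℕ.* b) _ _ (begin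
      suc k ℕ.* b ℕ.+ suc k ℕ.* a
        ≡⟨ ℕ.*-distribˡ-+ (suc k) b a ⟨
      suc k ℕ.* (b ℕ.+ a)
        ≡⟨ cong (λ m → suc k ℕ.* ((m C k) ℕ.+ (n C suc k))) (ℕ.+-suc k (suc k)) ⟩
      suc k ℕ.* ((n C k) ℕ.+ (n C suc k))
        ≡⟨ cong (suc k ℕ.*_) (nCk+nC[k+1]≡[n+1]C[k+1] n k) ⟩
      suc k ℕ.* (suc n C suc k)
        ≡⟨ absorption n k ⟩
      suc n ℕ.* (n C k)
        ≡⟨ cong (λ m → suc n ℕ.* (m C k)) (ℕ.+-suc k (suc k)) ⟨
      suc n ℕ.* b
        ≡⟨ split k b ⟩
      suc k ℕ.* b ℕ.+ (2 ℕ.+ k) ℕ.* b ∎)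
      where
      split : ∀ k b → suc (suc k ℕ.+ suc k) ℕ.* b ≡ suc k ℕ.* b ℕ.+ (2 ℕ.+ k) ℕ.* b
      split = ℕ.solve-∀
    b≤a : b ℕ.≤ a
    b≤a = ℕ.*-cancelˡ-≤ (suc k) (ℕ.≤-trans (ℕ.m≤n+m (suc k ℕ.* b) b) (ℕ.≤-reflexive (sym ratio)))
    -- This shows that the division in `catalan` is exact, with quotient a - b.
    a-factor : a ≡ (a ℕ.∸ b) ℕ.* (2 ℕ.+ k)
    a-factor = sym (begin
      (a ℕ.∸ b) ℕ.* (2 ℕ.+ k)
        ≡⟨ ℕ.*-distribʳ-∸ (2 ℕ.+ k) a b ⟩
      a ℕ.* (2 ℕ.+ k) ℕ.∸ b ℕ.* (2 ℕ.+ k)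
        ≡⟨ cong₂ ℕ._∸_ (ℕ.*-suc a (suc k)) (ℕ.*-comm b (2 ℕ.+ k)) ⟩
      a ℕ.+ a ℕ.* suc k ℕ.∸ (2 ℕ.+ k) ℕ.* b
        ≡⟨ cong (λ z → a ℕ.+ z ℕ.∸ (2 ℕ.+ k) ℕ.* b) (trans (ℕ.*-comm a (suc k)) ratio) ⟩
      a ℕ.+ (2 ℕ.+ k) ℕ.* b ℕ.∸ (2 ℕ.+ k) ℕ.* b
        ≡⟨ ℕ.m+n∸n≡m a ((2 ℕ.+ k) ℕ.* b) ⟩
      a ∎)

  -- Walks with steps ±1 and Dyck paths

  flank : Seq → Seq
  flank f i = f (i + - 1ℤ) + f (i + 1ℤ)

  -- The coefficients of (x⁻¹ + x)ⁿ, counting the walks of n steps ±1 from 0 by endpoint.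
  walks : ℕ → Seq
  walks n = iter flank n δ

  walks-beyond : ∀ n c → walks n (+ (suc n ℕ.+ c)) ≡ 0ℤ
  walks-beyond zero    c = refl
  walks-beyond (suc n) c = cong₂ _+_ (walks-beyond n c)
    (trans (cong (walks n) (cong +_ (reorder n c))) (walks-beyond n (2 ℕ.+ c)))
    where
    reorder : ∀ n c → suc (suc n) ℕ.+ c ℕ.+ 1 ≡ suc n ℕ.+ (2 ℕ.+ c)
    reorder = ℕ.solve-∀

  walks-sym : ∀ n i → walks n (- i) ≡ walks n i
  walks-sym zero    i = δ-sym i
  walks-sym (suc n) i = trans
    (cong₂ (λ x y → walks n x + walks n y) (negate i (- 1ℤ)) (negate i 1ℤ))
    (trans (cong₂ _+_ (walks-sym n (i + 1ℤ)) (walks-sym n (i + - 1ℤ))) (+-comm (walks n (i + 1ℤ)) _))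
    where
    negate : ∀ i a → - i + a ≡ - (i + - a)
    negate = solve-∀

  walks-top : ∀ n → walks n (+ n) ≡ 1ℤ
  walks-top zero    = refl
  walks-top (suc n) = cong₂ _+_ (walks-top n) (walks-beyond n 1)

  -- Such a walk has b steps up and a down; splitting by the last step is Pascal's rule.
  walks-binomial : ∀ a b → walks (a ℕ.+ b) (+ b - + a) ≡ + ((a ℕ.+ b) C a)
  walks-binomial zero    b       = trans (cong (walks b) (+-identityʳ (+ b))) (walks-top b)
  walks-binomial (suc a) zero    = trans
    (cong₂ walks (ℕ.+-identityʳ (suc a)) (+-identityˡ (- + suc a)))
    (trans (walks-sym (suc a) (+ suc a)) (trans (walks-top (suc a))
      (sym (trans (cong (λ n → + (n C suc a)) (ℕ.+-identityʳ (suc a))) (cong +_ (nCn≡1 (suc a)))))))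
  walks-binomial (suc a) (suc b) = begin
    walks (a ℕ.+ suc b) (i + - 1ℤ) + walks (a ℕ.+ suc b) (i + 1ℤ)
      ≡⟨ cong₂ _+_ (trans (cong₂ walks (ℕ.+-suc a b) (low (+ a) (+ b))) (walks-binomial (suc a) b))
                   (trans (cong (walks (a ℕ.+ suc b)) (high (+ a) (+ b))) (walks-binomial a (suc b))) ⟩
    + ((suc a ℕ.+ b) C suc a) + + ((a ℕ.+ suc b) C a)
      ≡⟨ +-comm (+ ((suc a ℕ.+ b) C suc a)) (+ ((a ℕ.+ suc b) C a)) ⟩
    + (((a ℕ.+ suc b) C a) ℕ.+ ((suc a ℕ.+ b) C suc a))
      ≡⟨ cong (λ n → + (((a ℕ.+ suc b) C a) ℕ.+ (n C suc a))) (ℕ.+-suc a b) ⟨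
    + (((a ℕ.+ suc b) C a) ℕ.+ ((a ℕ.+ suc b) C suc a))
      ≡⟨ cong +_ (nCk+nC[k+1]≡[n+1]C[k+1] (a ℕ.+ suc b) a) ⟩
    + (suc (a ℕ.+ suc b) C suc a) ∎
    where
    open ≡-Reasoning
    i = + suc b - + suc a
    low : ∀ a b → (1ℤ + b) - (1ℤ + a) + - 1ℤ ≡ b - (1ℤ + a)
    low = solve-∀
    high : ∀ a b → (1ℤ + b) - (1ℤ + a) + 1ℤ ≡ (1ℤ + b) - a
    high = solve-∀

  -- The endpoint has the parity of the length; the odd and even cases are proved by mutual
  -- induction.
  walks-odd : ∀ k q → walks (suc (k ℕ.+ k)) (q + q) ≡ 0ℤ
  walks-even : ∀ k q → walks (k ℕ.+ k) (1ℤ + (q + q)) ≡ 0ℤ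
  walks-odd k q = cong₂ _+_
    (trans (cong (walks (k ℕ.+ k)) (low q)) (walks-even k (q + - 1ℤ)))
    (trans (cong (walks (k ℕ.+ k)) (+-comm (q + q) 1ℤ)) (walks-even k q))
    where
    low : ∀ q → q + q + - 1ℤ ≡ 1ℤ + (q + - 1ℤ + (q + - 1ℤ))
    low = solve-∀
  walks-even zero    (+ zero)       = refl
  walks-even zero    +[1+ n ]       = refl
  walks-even zero    -[1+ n ]       = refl
  walks-even (suc k) q rewrite ℕ.+-suc k k = cong₂ _+_
    (trans (cong (walks (suc (k ℕ.+ k))) (low q)) (walks-odd k q))
    (trans (cong (walks (suc (k ℕ.+ k))) (high q)) (walks-odd k (q + 1ℤ)))
    where
    low : ∀ q → 1ℤ + (q + q) + - 1ℤ ≡ q + q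
    low = solve-∀
    high : ∀ q → 1ℤ + (q + q) + 1ℤ ≡ q + 1ℤ + (q + 1ℤ)
    high = solve-∀

  -- walks j 0 - walks j 2 counts Dyck paths of length j.
  dyck : ℕ → ℤ
  dyck j = walks j (+ 0) - walks j (+ 2)

  dyck-odd : ∀ k → dyck (suc (k ℕ.+ k)) ≡ 0ℤ
  dyck-odd k = cong₂ _-_ (walks-odd k 0ℤ) (walks-odd k 1ℤ)

  dyck-even : ∀ k → dyck (k ℕ.+ k) ≡ + catalan k
  dyck-even zero    = refl
  dyck-even (suc k) = begin
    walks (suc k ℕ.+ suc k) (+ 0) - walks (suc k ℕ.+ suc k) (+ 2)
      ≡⟨ cong₂ _-_ (trans (cong (walks (suc k ℕ.+ suc k)) (sym (+-inverseʳ (+ suc k))))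
                          (walks-binomial (suc k) (suc k)))
                   (trans (cong₂ walks (sym (ℕ.+-suc k (suc k))) (two (+ k)))
                          (walks-binomial k (suc (suc k)))) ⟩
    + ((suc k ℕ.+ suc k) C suc k) - + ((k ℕ.+ suc (suc k)) C k)
      ≡⟨ cong (λ n → + n - + ((k ℕ.+ suc (suc k)) C k)) (catalan-ballot k) ⟨
    + catalan (suc k) + + ((k ℕ.+ suc (suc k)) C k) - + ((k ℕ.+ suc (suc k)) C k)
      ≡⟨ +-forthback (+ catalan (suc k)) (+ ((k ℕ.+ suc (suc k)) C k)) ⟩
    + catalan (suc k) ∎
    where
    open ≡-Reasoning
    two : ∀ k → + 2 ≡ (+ 2 + k) - k
    two = solve-∀

  -- Finite sums and the binomial transform

  Σ< : ℕ → (ℕ → ℤ) → ℤ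
  Σ< zero    f = 0ℤ
  Σ< (suc n) f = f 0 + Σ< n (f ∘ suc)

  Σ<-cong : ∀ n {f g : ℕ → ℤ} → f ≗ g → Σ< n f ≡ Σ< n g
  Σ<-cong zero    e = refl
  Σ<-cong (suc n) e = cong₂ _+_ (e 0) (Σ<-cong n (e ∘ suc))

  Σ<-+ : ∀ n f g → Σ< n (λ k → f k + g k) ≡ Σ< n f + Σ< n g
  Σ<-+ zero    f g = refl
  Σ<-+ (suc n) f g rewrite Σ<-+ n (f ∘ suc) (g ∘ suc) = swap (f 0) (g 0) (Σ< n (f ∘ suc)) (Σ< n (g ∘ suc))
    where
    swap : ∀ a b c d → a + b + (c + d) ≡ a + c + (b + d)
    swap = solve-∀

  Σ<-zero : ∀ n {f : ℕ → ℤ} → (∀ k → f k ≡ 0ℤ) → Σ< n f ≡ 0ℤ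
  Σ<-zero zero    e = refl
  Σ<-zero (suc n) e = cong₂ _+_ (e 0) (Σ<-zero n (e ∘ suc))

  Σ<-pairs : ∀ n f → Σ< (n ℕ.+ n) f ≡ Σ< n (λ k → f (k ℕ.+ k) + f (suc (k ℕ.+ k)))
  Σ<-pairs zero    f = refl
  Σ<-pairs (suc n) f rewrite ℕ.+-suc n n = trans (sym (+-assoc (f 0) (f 1) _))
    (cong (λ z → f 0 + f 1 + z) (trans (Σ<-pairs n (f ∘ suc ∘ suc))
      (Σ<-cong n λ k → cong (λ m → f (suc m) + f (suc (suc m))) (sym (ℕ.+-suc k k)))))

  sum-applyUpTo : ∀ f n → + sum (applyUpTo f n) ≡ Σ< n (+_ ∘ f)
  sum-applyUpTo f zero    = refl
  sum-applyUpTo f (suc n) = cong (λ z → + f 0 + z) (sum-applyUpTo (f ∘ suc) n)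

  binomialSum : ℕ → ℕ → (ℕ → ℤ) → ℤ
  binomialSum N n g = Σ< N (λ j → + (n C j) * g j)

  binomialSum-pascal : ∀ N n g →
    binomialSum (suc N) (suc n) g ≡ binomialSum (suc N) n g + binomialSum N n (g ∘ suc)
  binomialSum-pascal N n g = trans
    (cong (λ z → 1ℤ * g 0 + z) (trans
      (Σ<-cong N λ j → trans (cong (λ m → + m * g (suc j)) (sym (nCk+nC[k+1]≡[n+1]C[k+1] n j)))
                             (expand (+ (n C j)) (+ (n C suc j)) (g (suc j))))
      (Σ<-+ N (λ j → + (n C suc j) * g (suc j)) (λ j → + (n C j) * g (suc j)))))
    (sym (+-assoc (1ℤ * g 0) _ _))
    where
    expand : ∀ a b x → (a + b) * x ≡ b * x + a * x
    expand = solve-∀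

  binomialSum-zero : ∀ N g → binomialSum (suc N) 0 g ≡ g 0
  binomialSum-zero N g = trans (cong₂ _+_ (*-identityˡ (g 0))
      (Σ<-zero N λ j → cong (λ m → + m * g (suc j)) (k>n⇒nCk≡0 {0} {suc j} (s≤s z≤n))))
    (+-identityʳ (g 0))

  spread-flank : ∀ f → spread 1ℤ f ≗ λ i → 1ℤ * f i + 1ℤ * flank f i
  spread-flank f i = regroup (f (i + - 1ℤ)) (f i) (f (i + 1ℤ))
    where
    regroup : ∀ a b c → a + b + c ≡ 1ℤ * b + 1ℤ * (a + c)
    regroup = solve-∀

  iter-suc : {A : Set} (F : A → A) (n : ℕ) (f : A) → iter F (suc n) f ≡ iter F n (F f)
  iter-suc F zero    f = refl
  iter-suc F (suc n) f = cong F (iter-suc F n f)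

  -- Pascal's rule unfolds (1 + (x + x⁻¹))ⁿ into the binomial transform of the walk counts.
  binomialSum-dyck : ∀ n d s → binomialSum (suc (n ℕ.+ d)) n (λ j → dyck (j ℕ.+ s)) ≡
    iter (spread 1ℤ) n (walks s) (+ 0) - iter (spread 1ℤ) n (walks s) (+ 2)
  binomialSum-dyck zero    d s = binomialSum-zero d (λ j → dyck (j ℕ.+ s))
  -- Pascal's rule splits the sum in two: one part raises the slack d in the summation bound by 1,
  -- the other lengthens the walks from s to s + 1.
  binomialSum-dyck (suc n) d s = begin
    binomialSum (suc (suc n ℕ.+ d)) (suc n) g
      ≡⟨ binomialSum-pascal (suc n ℕ.+ d) n g ⟩
    binomialSum (suc (suc n ℕ.+ d)) n g + binomialSum (suc n ℕ.+ d) n (g ∘ suc)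
      ≡⟨ cong₂ _+_ (trans (cong (λ m → binomialSum (suc m) n g) (sym (ℕ.+-suc n d))) (binomialSum-dyck n (suc d) s))
                   (trans (Σ<-cong (suc n ℕ.+ d) λ j → cong (λ m → + (n C j) * dyck m) (sym (ℕ.+-suc j s)))
                          (binomialSum-dyck n d (suc s))) ⟩
    (x s (+ 0) - x s (+ 2)) + (x (suc s) (+ 0) - x (suc s) (+ 2))
      ≡⟨ regroup (x s (+ 0)) (x s (+ 2)) (x (suc s) (+ 0)) (x (suc s) (+ 2)) ⟩
    (1ℤ * x s (+ 0) + 1ℤ * x (suc s) (+ 0)) - (1ℤ * x s (+ 2) + 1ℤ * x (suc s) (+ 2))
      ≡⟨ cong₂ _-_ (merge (+ 0)) (merge (+ 2)) ⟨
    iter (spread 1ℤ) (suc n) (walks s) (+ 0) - iter (spread 1ℤ) (suc n) (walks s) (+ 2) ∎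
    where
    open ≡-Reasoning
    g : ℕ → ℤ
    g j = dyck (j ℕ.+ s)
    x : ℕ → Seq
    x t = iter (spread 1ℤ) n (walks t)
    regroup : ∀ a b c d → (a - b) + (c - d) ≡ (1ℤ * a + 1ℤ * c) - (1ℤ * b + 1ℤ * d)
    regroup = solve-∀
    conv = iter-convolution (spread-convolution 1ℤ) n
    merge : ∀ i → iter (spread 1ℤ) (suc n) (walks s) i ≡ 1ℤ * x s i + 1ℤ * x (suc s) i
    merge i = trans (cong (λ f → f i) (iter-suc (spread 1ℤ) n (walks s)))
      (trans (ext conv (spread-flank (walks s)) i) (linear conv 1ℤ 1ℤ (walks s) (walks (suc s)) i))

  -- Inserting the vanishing odd terms turns the defining sum into the binomial transform of `dyck`
  -- over j < 2n + 2, the case s = 0 of `binomialSum-dyck`.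
  motzkin-trinomial : ∀ n → + motzkin n ≡ T₀ n - T₂ n
  motzkin-trinomial n = begin
    + motzkin n
      ≡⟨ cong (+_ ∘ sum) (List.map-upTo (λ k → (n C (2 ℕ.* k)) ℕ.* catalan k) (suc n)) ⟩
    + sum (applyUpTo (λ k → (n C (2 ℕ.* k)) ℕ.* catalan k) (suc n))
      ≡⟨ sum-applyUpTo (λ k → (n C (2 ℕ.* k)) ℕ.* catalan k) (suc n) ⟩
    Σ< (suc n) (λ k → + ((n C (2 ℕ.* k)) ℕ.* catalan k))
      ≡⟨ Σ<-cong (suc n) pair ⟩
    Σ< (suc n) (λ k → f (k ℕ.+ k) + f (suc (k ℕ.+ k)))
      ≡⟨ Σ<-pairs (suc n) f ⟨
    Σ< (suc n ℕ.+ suc n) f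
      ≡⟨ Σ<-cong (suc n ℕ.+ suc n) (λ j → cong (λ m → + (n C j) * dyck m) (sym (ℕ.+-identityʳ j))) ⟩
    binomialSum (suc (n ℕ.+ suc n)) n (λ j → dyck (j ℕ.+ 0))
      ≡⟨ binomialSum-dyck n (suc n) 0 ⟩
    T₀ n - T₂ n ∎
    where
    open ≡-Reasoning
    f : ℕ → ℤ
    f j = + (n C j) * dyck j
    twice : ∀ k → 2 ℕ.* k ≡ k ℕ.+ k
    twice = ℕ.solve-∀
    pair : ∀ k → + ((n C (2 ℕ.* k)) ℕ.* catalan k) ≡ f (k ℕ.+ k) + f (suc (k ℕ.+ k))
    pair k = trans (pos-* (n C (2 ℕ.* k)) (catalan k)) (trans
      (cong₂ (λ m c → + (n C m) * c) (twice k) (sym (dyck-even k)))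
      (sym (trans (cong (λ z → f (k ℕ.+ k) + z)
                    (trans (cong (+ (n C suc (k ℕ.+ k)) *_) (dyck-odd k)) (*-zeroʳ (+ (n C suc (k ℕ.+ k))))))
                  (+-identityʳ (f (k ℕ.+ k))))))

  [n+2]motzkin : ∀ n → (+ 2 + + n) * + motzkin n ≡ + 2 * T₀ n + T₁ n
  [n+2]motzkin n = trans (cong (λ M → (+ 2 + + n) * M) (motzkin-trinomial n)) (i-j≡0⇒i≡j _ _ (trans
    (rearrange (+ n) (T₀ n) (T₁ n) (T₂ n)) (cong -_ (i≡j⇒i-j≡0 (T₂-eliminate n)))))
    where
    rearrange : ∀ n a b c → (+ 2 + n) * (a - c) - (+ 2 * a + b) ≡ - ((+ 2 + n) * c - (n * a - b))
    rearrange = solve-∀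

  [n+1]motzkin : ∀ n → (1ℤ + + n) * + motzkin n ≡ T₁ (suc n)
  [n+1]motzkin n = trans (cong (λ M → (1ℤ + + n) * M) (motzkin-trinomial n)) (i-j≡0⇒i≡j _ _ (trans
    (rearrange (+ n) (T₀ n) (T₁ n) (T₂ n)) (cong -_ (i≡j⇒i-j≡0 (T₂-eliminate n)))))
    where
    rearrange : ∀ n a b c → (1ℤ + n) * (a - c) - (a + b + c) ≡ - ((+ 2 + n) * c - (n * a - b))
    rearrange = solve-∀

-- Certificates for the primes below 200 and the theorem

open TrinomialCoefficients
open import Defs
open import Data.Nat using (ℕ; zero; suc; _<_; _*_)
import Data.Nat.Properties as ℕ
open import Data.Nat.Divisibility using (_∣_; _∣?_)
open import Data.Nat.Primality using (Prime; prime?)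
open import Data.Integer.Base using (+_)
import Data.Integer.Divisibility.Signed as ℤ
open import Data.List.Base using (List; []; _∷_; map)
open import Data.List.Membership.DecPropositional ℕ._≟_ using (_∈?_)
open import Data.List.Membership.Propositional using (_∈_; _∉_)
open import Data.List.Membership.Propositional.Properties using (∈-map⁻)
open import Data.List.Relation.Unary.All as All using (All)
open import Data.Product using (_×_; _,_; proj₁; ∃-syntax; uncurry)
open import Data.Sum using (_⊎_; [_,_]′)
open import Function using (_∘_)
open import Relation.Binary.PropositionalEquality using (_≡_; refl)
open import Relation.Nullary using (¬_)
open import Relation.Nullary.Decidable using (Dec; from-yes; _→-dec_; _⊎-dec_; ¬?)

-- For each exceptional prime, the states ⟨ a , b , c , d ⟩ reachable from the two initial ones that are not
-- multiples of T₀.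
automata : List (ℕ × List State)
automata =
    (5   , ⟨ + 4 , + 5 , + 1 , + 0 ⟩ ∷ ⟨ + 16 , + 15 , + 1 , + 0 ⟩ ∷ ⟨ + 10 , + 20 , + 20 , + 20 ⟩
         ∷ ⟨ + 22 , + 20 , + 1 , + 0 ⟩ ∷ ⟨ + 15 , + 5 , + 20 , + 20 ⟩ ∷ ⟨ + 10 , + 10 , + 1 , + 0 ⟩
         ∷ ⟨ + 5 , + 20 , + 20 , + 20 ⟩ ∷ ⟨ + 10 , + 5 , + 20 , + 20 ⟩ ∷ [])
  ∷ (13  , ⟨ + 158 , + 156 , + 1 , + 0 ⟩ ∷ ⟨ + 117 , + 117 , + 1 , + 0 ⟩
         ∷ ⟨ + 52 , + 0 , + 156 , + 156 ⟩ ∷ ⟨ + 117 , + 0 , + 13 , + 13 ⟩ ∷ [])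
  ∷ (31  , ⟨ + 312 , + 310 , + 1 , + 0 ⟩ ∷ ⟨ + 217 , + 217 , + 1 , + 0 ⟩
         ∷ ⟨ + 744 , + 0 , + 930 , + 930 ⟩ ∷ ⟨ + 217 , + 0 , + 31 , + 31 ⟩ ∷ [])
  ∷ (37  , ⟨ + 1001 , + 999 , + 1 , + 0 ⟩ ∷ ⟨ + 1036 , + 1036 , + 1 , + 0 ⟩
         ∷ ⟨ + 333 , + 0 , + 1332 , + 1332 ⟩ ∷ ⟨ + 1036 , + 0 , + 37 , + 37 ⟩ ∷ [])
  ∷ (61  , ⟨ + 3052 , + 3050 , + 1 , + 0 ⟩ ∷ ⟨ + 1464 , + 1464 , + 1 , + 0 ⟩
         ∷ ⟨ + 2257 , + 0 , + 3660 , + 3660 ⟩ ∷ ⟨ + 1464 , + 0 , + 61 , + 61 ⟩ ∷ [])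
  ∷ (79  , ⟨ + 160 , + 158 , + 1 , + 0 ⟩ ∷ ⟨ + 4108 , + 4108 , + 1 , + 0 ⟩
         ∷ ⟨ + 2133 , + 0 , + 6162 , + 6162 ⟩ ∷ ⟨ + 4108 , + 0 , + 79 , + 79 ⟩ ∷ [])
  ∷ (97  , ⟨ + 5725 , + 5723 , + 1 , + 0 ⟩ ∷ ⟨ + 4365 , + 4365 , + 1 , + 0 ⟩
         ∷ ⟨ + 5044 , + 0 , + 9312 , + 9312 ⟩ ∷ ⟨ + 4365 , + 0 , + 97 , + 97 ⟩ ∷ [])
  ∷ (103 , ⟨ + 7521 , + 7519 , + 1 , + 0 ⟩ ∷ ⟨ + 1030 , + 1030 , + 1 , + 0 ⟩
         ∷ ⟨ + 9579 , + 0 , + 10506 , + 10506 ⟩ ∷ ⟨ + 1030 , + 0 , + 103 , + 103 ⟩ ∷ [])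
  ∷ []

-- Digits, least significant first, of an index n with p² ∣ M(n).
witnesses : List (ℕ × List ℕ)
witnesses =
    (7 , 2 ∷ 3 ∷ []) ∷ (11 , 10 ∷ 1 ∷ []) ∷ (17 , 1 ∷ 11 ∷ []) ∷ (19 , 8 ∷ 3 ∷ [])
  ∷ (23 , 22 ∷ 1 ∷ 21 ∷ []) ∷ (29 , 28 ∷ 14 ∷ 11 ∷ []) ∷ (41 , 14 ∷ 32 ∷ []) ∷ (43 , 2 ∷ 9 ∷ [])
  ∷ (47 , 11 ∷ 23 ∷ []) ∷ (53 , 52 ∷ 36 ∷ 4 ∷ []) ∷ (59 , 34 ∷ 24 ∷ []) ∷ (67 , 66 ∷ 65 ∷ 9 ∷ [])
  ∷ (71 , 70 ∷ 1 ∷ 41 ∷ []) ∷ (73 , 8 ∷ 9 ∷ []) ∷ (83 , 82 ∷ 82 ∷ 81 ∷ 8 ∷ []) ∷ (89 , 66 ∷ 3 ∷ [])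
  ∷ (101 , 100 ∷ 1 ∷ 40 ∷ []) ∷ (107 , 76 ∷ 28 ∷ []) ∷ (109 , 53 ∷ 61 ∷ []) ∷ (113 , 37 ∷ 12 ∷ [])
  ∷ (127 , 117 ∷ 45 ∷ []) ∷ (131 , 18 ∷ 7 ∷ []) ∷ (137 , 112 ∷ 7 ∷ []) ∷ (139 , 138 ∷ 137 ∷ 4 ∷ [])
  ∷ (149 , 148 ∷ 92 ∷ 52 ∷ []) ∷ (151 , 150 ∷ 149 ∷ 34 ∷ []) ∷ (157 , 156 ∷ 155 ∷ 20 ∷ [])
  ∷ (163 , 110 ∷ 25 ∷ []) ∷ (167 , 166 ∷ 1 ∷ 64 ∷ []) ∷ (173 , 79 ∷ 61 ∷ []) ∷ (179 , 59 ∷ 44 ∷ [])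
  ∷ (181 , 180 ∷ 57 ∷ 116 ∷ []) ∷ (191 , 48 ∷ 70 ∷ []) ∷ (193 , 37 ∷ 141 ∷ 1 ∷ [])
  ∷ (197 , 196 ∷ 1 ∷ 45 ∷ []) ∷ (199 , 37 ∷ 61 ∷ [])
  ∷ []

automata-closed : All (uncurry Closed) automata
automata-closed = from-yes (All.all? (uncurry closed?) automata)

witnesses-vanish : All (uncurry Witness) witnesses
witnesses-vanish = from-yes (All.all? (uncurry witness?) witnesses)

exceptional-covered : All (λ p → p ∈ map proj₁ automata) exceptionalPrimes
exceptional-covered = from-yes (All.all? (_∈? map proj₁ automata) exceptionalPrimes)

Covered : ℕ → Set
Covered p = Prime p → p ∉ exceptionalPrimes → p ≡ 2 ⊎ p ≡ 3 ⊎ p ∈ map proj₁ witnesses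

primes-covered : ∀ {p} → p < 200 → Covered p
primes-covered = from-yes (ℕ.allUpTo? covered? 200)
  where
  covered? : ∀ p → Dec (Covered p)
  covered? p = prime? p →-dec ¬? (p ∈? exceptionalPrimes) →-dec
    ((p ℕ.≟ 2) ⊎-dec (p ℕ.≟ 3) ⊎-dec (p ∈? map proj₁ witnesses))

closed⇒p²∤motzkin : ∀ p S → Prime p → Closed p S → ∀ n → ¬ (p * p ∣ motzkin n)
closed⇒p²∤motzkin 0 S ()
closed⇒p²∤motzkin 1 S ()
closed⇒p²∤motzkin (suc (suc p-2)) S pr closed n =
  closed⇒p²∤ p-2 S pr closed (+ motzkin n) n ([n+2]motzkin n) ([n+1]motzkin n) ∘ ℤ.∣ᵤ⇒∣

witness⇒p²∣motzkin : ∀ p ss → Prime p → Witness p ss → ∃[ n ] (p * p ∣ motzkin n)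
witness⇒p²∣motzkin zero      ss ()
witness⇒p²∣motzkin (suc p-1) ss pr witness =
  n , ℤ.∣⇒∣ᵤ (witness⇒p²∣ p-1 ss pr witness (+ motzkin n) ([n+2]motzkin n))
  where n = fromDigits (suc p-1) ss

p²∤motzkin : ∀ {p} → Prime p → p ∈ map proj₁ automata → ∀ n → ¬ (p * p ∣ motzkin n)
p²∤motzkin pr p∈ with ∈-map⁻ proj₁ p∈
... | (p , S) , pS∈ , refl = closed⇒p²∤motzkin p S pr (All.lookup automata-closed pS∈)

p²∣motzkin : ∀ {p} → Prime p → p ∈ map proj₁ witnesses → ∃[ n ] (p * p ∣ motzkin n)
p²∣motzkin pr p∈ with ∈-map⁻ proj₁ p∈
... | (p , ss) , pss∈ , refl = witness⇒p²∣motzkin p ss pr (All.lookup witnesses-vanish pss∈)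

theorem3p3 : ((p : ℕ) → Prime p → p ∈ exceptionalPrimes → (n : ℕ) → ¬ (p * p ∣ motzkin n))
    × ((p : ℕ) → Prime p → p < 200 → p ∉ exceptionalPrimes → ∃[ n ] (p * p ∣ motzkin n))
theorem3p3 = (λ p pr p∈ → p²∤motzkin pr (All.lookup exceptional-covered p∈)) , λ p pr p<200 p∉ →
  -- The method inverts 6 modulo p², so 2 and 3 are settled directly by M(3) = 4 and M(4) = 9.
  [ (λ { refl → 3 , from-yes (4 ∣? motzkin 3) }) , [ (λ { refl → 4 , from-yes (9 ∣? motzkin 4) }) , p²∣motzkin pr ]′ ]′
    (primes-covered p<200 pr p∉)
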